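{- For every integer $n \geq 10$ such that $n = 12$ or $n \bmod 18 \notin \{6,12\}$, it holds that $\mathrm{WL}_1(n) = n-1$.
   Context: All graphs are finite, simple and undirected. Colour Refinement on a graph $G$ (with monochromatic initial colouring) computes colourings $\chi^i_G$: $\chi^0_G$ is constant, and for $i \geq 1$, $\chi^i_G(v) = \big(\chi^{i-1}_G(v), \{\!\{\chi^{i-1}_G(w) \mid w \in N(v)\}\!\}\big)$, where $N(v)$ is the neighbourhood of $v$ and $\{\!\{\cdot\}\!\}$ denotes a multiset. Let $\pi^i_G$ be the partition of $V(G)$ into colour classes of $\chi^i_G$. $\mathrm{WL}_1(G)$ is the least $j \geq 0$ such that $\pi^j_G = \pi^{j+1}_G$ (the number of iterations until stabilisation), and for $n \in \mathbb{N}$, $\mathrm{WL}_1(n)$ is the maximum of $\mathrm{WL}_1(G)$ over all graphs $G$ with $n$ vertices. -}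

module Defs where

open import Data.Nat using (ℕ; zero; suc; _<_; _≡ᵇ_)
open import Data.Bool using (Bool; true; false; _∧_)
open import Data.Fin using (Fin)
open import Data.List using (List; allFin; filter; length; foldr)
open import Data.Product using (_×_)
open import Relation.Nullary using (¬_)
open import Relation.Binary.PropositionalEquality using (_≡_)
open import Data.Bool.Properties using (T?)

record Graph (n : ℕ) : Set where
  field
    adj   : Fin n → Fin n → Bool
    sym   : ∀ u v → adj u v ≡ adj v u
    irrefl : ∀ v → adj v v ≡ false
open Graph public

count : {n : ℕ} → (Fin n → Bool) → ℕ
count {n} p = length (filter (λ x → T? (p x)) (allFin n))

allB : {A : Set} → (A → Bool) → List A → Bool
allB p = foldr (λ a b → p a ∧ b) true

-- sameColour G i v w  =  true  iff  χ^i_G(v) = χ^i_G(w).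
-- χ^0 is constant. χ^{i+1}(v) = χ^{i+1}(w) iff χ^i(v) = χ^i(w) and the
-- multisets {{χ^i(x) | x ∈ N(v)}} and {{χ^i(x) | x ∈ N(w)}} coincide, i.e.
-- for every colour c (every colour occurring is χ^i(u) for some vertex u)
-- v and w have the same number of neighbours of colour c.
sameColour : {n : ℕ} → Graph n → ℕ → Fin n → Fin n → Bool
sameColour G zero    v w = true
sameColour {n} G (suc i) v w =
  sameColour G i v w ∧
  allB (λ u → count (λ x → adj G v x ∧ sameColour G i x u)
             ≡ᵇ count (λ x → adj G w x ∧ sameColour G i x u))
      (allFin n)

Stable : {n : ℕ} → Graph n → ℕ → Set
Stable {n} G j = ∀ (v w : Fin n) → sameColour G j v w ≡ sameColour G (suc j) v w

IsWL1 : {n : ℕ} → Graph n → ℕ → Set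
IsWL1 G k = Stable G k × (∀ j → j < k → ¬ Stable G j)

IsWL1Max : ℕ → ℕ → Set
IsWL1Max n k =
  (Data.Product.∃ λ (G : Graph n) → IsWL1 G k) ×
  (∀ (G : Graph n) (m : ℕ) → IsWL1 G m → m Data.Nat.≤ k)

module Submission where

-- An unstable round creates a new colour class and there are at most n of them, so WL₁(G) ≤ n − 1, with
-- equality as soon as G is not stable after n − 2 rounds.
--
-- The witnesses consist of pairs of vertices, arranged in three arms L, R and Z that stand on a base and carry
-- a top. Every round splits exactly one class. First a wave rises through the three arms simultaneously and
-- separates the levels. At the top L looks different from R and Z, and this difference travels down L. Through
-- the base it distinguishes R from Z, and that difference travels up again. At the top one vertex of the highest
-- pair of L is attached to the R side and the other one to the Z side: now this pair splits, and then all pairs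
-- split one after the other along the path that runs down L, up R and down Z.
--
-- Two bases and two tops give the orders 6K + 11, 6K + 13, 6K + 14 and 6K + 16. A hub adjacent to all vertices of
-- the smaller of the two degrees delays the refinement by one round, which gives 6K + 12 and 6K + 15. Only n = 10
-- remains, and it is settled by computation.

open import Defs hiding (sym)
open import Data.Bool using (Bool; true; false; _∧_; T; not; if_then_else_)
open import Data.Bool.Properties using (T-∧; T-≡; T?; ⇔→≡; ∧-zeroʳ) renaming (_≟_ to _≟ᵇ_)
open import Data.Empty using (⊥; ⊥-elim)
open import Data.Fin using (Fin; zero; suc; toℕ; fromℕ<; #_)
open import Data.Fin.Properties using (+↔⊎; *↔×; 2↔Bool; toℕ-fromℕ<; fromℕ<-toℕ; toℕ≤pred[n])
import Data.Fin.Properties as Fin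
open import Data.List using (List; []; _∷_; allFin; filter; length; map; tabulate)
open import Data.List.Properties using (∷-injective; length-map; map-∘; map-cong)
open import Data.List.Membership.Propositional using (_∈_; _∉_)
open import Data.List.Membership.Propositional.Properties using (∈-map⁺; ∈-map⁻; ∈-filter⁺; ∈-filter⁻; ∈-allFin; ∈-length)
open import Data.List.Membership.Propositional.Properties.WithK using (unique∧set⇒bag)
import Data.List.Membership.DecPropositional as DecMembership
open import Data.List.Relation.Unary.Any using (here; there)
open import Data.List.Relation.Unary.All using (All; []; _∷_)
import Data.List.Relation.Unary.All as All
import Data.List.Relation.Unary.All.Properties as AllProps
open import Data.List.Relation.Unary.AllPairs using ([]; _∷_)
open import Data.List.Relation.Unary.Unique.Propositional using (Unique)
import Data.List.Relation.Unary.Unique.Propositional.Properties as Unique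
open import Data.List.Relation.Binary.BagAndSetEquality using (∼bag⇒↭)
open import Data.List.Relation.Binary.Permutation.Propositional.Properties using (↭-length)
open import Data.List.Relation.Binary.Pointwise using (Pointwise; []; _∷_)
import Data.List.Relation.Binary.Pointwise as Pointwise
open import Data.Nat using (ℕ; zero; suc; _+_; _*_; _∸_; _%_; _⊓_; _≤_; _<_; _≡ᵇ_; z≤n; s≤s; s≤s⁻¹)
open import Data.Nat.DivMod using (_divMod_; result)
open import Data.Nat.Properties
open import Data.Nat.Tactic.RingSolver using (solve-∀)
open import Data.Product using (_×_; _,_; proj₁; proj₂; ∃; ∃₂)
open import Data.Product.Function.NonDependent.Propositional using (_×-↔_)
open import Data.Sum using (_⊎_; inj₁; inj₂)
open import Data.Sum.Function.Propositional using (_⊎-↔_)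
open import Data.Unit using (tt)
open import Data.Vec using (Vec; []; _∷_)
import Data.Vec as Vec
open import Data.Vec.Properties using (lookup∘tabulate; lookup-replicate)
open import Function using (_∘_; id; Equivalence; mk⇔; _↔_; mk↔ₛ′; Inverse)
open import Function.Properties.Inverse using (↔-refl; ↔-trans)
open import Relation.Binary using (IsEquivalence)
open import Relation.Binary.PropositionalEquality
open import Relation.Nullary using (¬_; Dec; yes; no; does; contradiction; recompute)
open import Relation.Nullary.Decidable using (decidable-stable; map′; does-⇔; dec-false; toWitness)

open Equivalence using (to; from)

-- Colour refinement on arbitrary graphs

T-injective : ∀ {a b} → (T a → T b) → (T b → T a) → a ≡ b
T-injective f g = ⇔→≡ {z = true} (mk⇔ (to T-≡ ∘ f ∘ from T-≡) (to T-≡ ∘ g ∘ from T-≡))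

T-allB⁻ : ∀ {n} {A : Set} (p : A → Bool) (f : Fin n → A) → T (allB p (tabulate f)) → ∀ x → T (p (f x))
T-allB⁻ p f t zero    = proj₁ (to T-∧ t)
T-allB⁻ p f t (suc x) = T-allB⁻ p (f ∘ suc) (proj₂ (to T-∧ t)) x

T-allB⁺ : ∀ {n} {A : Set} (p : A → Bool) (f : Fin n → A) → (∀ x → T (p (f x))) → T (allB p (tabulate f))
T-allB⁺ {zero}  p f h = tt
T-allB⁺ {suc n} p f h = from T-∧ (h zero , T-allB⁺ p (f ∘ suc) (h ∘ suc))

count-cong : ∀ {n} {p q : Fin n → Bool} → (∀ x → p x ≡ q x) → count p ≡ count q
count-cong {n} {p} {q} h = go (allFin n)
  where
  go : ∀ xs → length (filter (λ x → T? (p x)) xs) ≡ length (filter (λ x → T? (q x)) xs)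
  go [] = refl
  go (x ∷ xs) with p x | q x | h x
  ... | true  | _ | refl = cong suc (go xs)
  ... | false | _ | refl = go xs

module Refinement {n : ℕ} (G : Graph n) where

  -- A record, because i, v and w cannot be inferred from the unfolded sameColour.
  record Same (i : ℕ) (v w : Fin n) : Set where
    constructor same
    field holds : T (sameColour G i v w)
  open Same public

  same? : ∀ i v w → Dec (Same i v w)
  same? i v w = map′ same holds (T? (sameColour G i v w))

  nbrCount : ℕ → Fin n → Fin n → ℕ
  nbrCount i v u = count (λ x → adj G v x ∧ sameColour G i x u)

  suc⁻ : ∀ {i v w} → Same (suc i) v w → Same i v w × (∀ u → nbrCount i v u ≡ nbrCount i w u)
  suc⁻ {i} {v} {w} (same s) =
    let a , b = to T-∧ s in
    same a , λ u → ≡ᵇ⇒≡ _ _ (T-allB⁻ (λ u → nbrCount i v u ≡ᵇ nbrCount i w u) id b u)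

  suc⁺ : ∀ {i v w} → Same i v w → (∀ u → nbrCount i v u ≡ nbrCount i w u) → Same (suc i) v w
  suc⁺ {i} {v} {w} (same a) b = same
    (from T-∧ (a , T-allB⁺ (λ u → nbrCount i v u ≡ᵇ nbrCount i w u) id (λ u → ≡⇒≡ᵇ _ _ (b u))))

  same-refl : ∀ i {v} → Same i v v
  same-refl zero    = same tt
  same-refl (suc i) = suc⁺ (same-refl i) (λ _ → refl)

  same-sym : ∀ i {v w} → Same i v w → Same i w v
  same-sym zero    _ = same tt
  same-sym (suc i) s = let a , b = suc⁻ s in suc⁺ (same-sym i a) (sym ∘ b)

  same-trans : ∀ i {u v w} → Same i u v → Same i v w → Same i u w
  same-trans zero    _ _ = same tt
  same-trans (suc i) s t =
    let a , b = suc⁻ s ; c , d = suc⁻ t in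
    suc⁺ (same-trans i a c) (λ u → trans (b u) (d u))

  same-pred : ∀ {i v w} → Same (suc i) v w → Same i v w
  same-pred = proj₁ ∘ suc⁻

  same-≤ : ∀ {i j v w} → i ≤ j → Same j v w → Same i v w
  same-≤ {zero}          z≤n     s = same tt
  same-≤ {suc i} {suc j} i≤j s with m≤n⇒m<n∨m≡n i≤j
  ... | inj₁ i<j  = same-≤ (s≤s⁻¹ i<j) (same-pred s)
  ... | inj₂ refl = s

  stable? : ∀ j → Dec (Stable G j)
  stable? j = Fin.all? λ v → Fin.all? λ w → sameColour G j v w ≟ᵇ sameColour G (suc j) v w

  stable⇒same-suc : ∀ {j} → Stable G j → ∀ {v w} → Same j v w → Same (suc j) v w
  stable⇒same-suc st {v} {w} (same s) = same (subst T (st v w) s)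

  same-suc⇒stable : ∀ {j} → (∀ v w → Same j v w → Same (suc j) v w) → Stable G j
  same-suc⇒stable {j} h v w = T-injective (holds ∘ h v w ∘ same) (holds ∘ same-pred {j} ∘ same)

  -- Stability at round `j` makes the counts of rounds `j` and `suc j` refer to the same classes, so
  -- the next round has nothing new to see.
  stable-suc : ∀ {j} → Stable G j → Stable G (suc j)
  stable-suc {j} st = same-suc⇒stable {suc j} λ v w s →
    let a , b = suc⁻ s in suc⁺ s λ u → trans (eq v u) (trans (b u) (sym (eq w u)))
    where
    eq : ∀ v u → nbrCount (suc j) v u ≡ nbrCount j v u
    eq v u = count-cong (λ x → cong (adj G v x ∧_) (sym (st x u)))

  stable-≤ : ∀ {i j} → i ≤ j → Stable G i → Stable G j
  stable-≤ {i} {j} i≤j st with m≤n⇒m<n∨m≡n i≤j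
  ... | inj₂ refl = st
  stable-≤ {i} {suc j} _ st | inj₁ i<j = stable-suc {j} (stable-≤ (s≤s⁻¹ i<j) st)

  unstable⇒split : ∀ {j} → ¬ Stable G j → ∃₂ λ v w → Same j v w × ¬ Same (suc j) v w
  unstable⇒split {j} ¬st
    with Fin.¬∀⟶∃¬ n _ (λ v → Fin.all? λ w → sameColour G j v w ≟ᵇ sameColour G (suc j) v w) ¬st
  ... | v , ¬stv
    with Fin.¬∀⟶∃¬ n _ (λ w → sameColour G j v w ≟ᵇ sameColour G (suc j) v w) ¬stv
  ... | w , neq with same? j v w | same? (suc j) v w
  ... | yes s | no ¬s' = v , w , s , ¬s'
  ... | yes s | yes s' = contradiction (T-injective (λ _ → holds s') (λ _ → holds s)) neq
  ... | no ¬s | _      = contradiction (T-injective (⊥-elim ∘ ¬s ∘ same) (holds ∘ same-pred {j} ∘ same)) neq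

  -- A family of `k` vertices with pairwise different colours witnesses at least `k` classes; this
  -- avoids forming the partition itself.
  Separated : ℕ → ∀ {k} → (Fin k → Fin n) → Set
  Separated j f = ∀ a b → Same j (f a) (f b) → a ≡ b

  separated-cons : ∀ {j k} {f : Fin k → Fin n} {v} → Separated j f → (∀ a → ¬ Same j v (f a)) →
    ∃ λ (g : Fin (suc k) → Fin n) → Separated j g
  separated-cons {j} {k} {f} {v} sep new = g , sep'
    where
    g : Fin (suc k) → Fin n
    g zero    = v
    g (suc a) = f a
    sep' : Separated j g
    sep' zero    zero    _ = refl
    sep' zero    (suc b) s = contradiction s (new b)
    sep' (suc a) zero    s = contradiction (same-sym j s) (new a)
    sep' (suc a) (suc b) s = cong suc (sep a b s)

  -- Let `v` and `w` be split in this round. If `v` shared its colour with no member of `f`, it can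
  -- be added. Otherwise `v` and `w` both had the colour of some `f a`, and at least one of them now
  -- differs from `f a`. By `around` that one differs from all other members as well, because it
  -- could only have agreed with `f a`.
  separated-suc : ∀ {j k} {f : Fin k → Fin n} → Separated j f → ¬ Stable G j →
    ∃ λ (g : Fin (suc k) → Fin n) → Separated (suc j) g
  separated-suc {j} {k} {f} sep ¬st = extend (unstable⇒split ¬st)
    where
    sep⁺ : Separated (suc j) f
    sep⁺ a b s = sep a b (same-pred s)

    around : ∀ {u} a → Same j u (f a) → ¬ Same (suc j) u (f a) → ∀ b → ¬ Same (suc j) u (f b)
    around a s ¬s b t with sep a b (same-trans j (same-sym j s) (same-pred t))
    ... | refl = ¬s t

    extend : (∃₂ λ v w → Same j v w × ¬ Same (suc j) v w) → ∃ λ (g : Fin (suc k) → Fin n) → Separated (suc j) g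
    extend (v , w , s , ¬s') with Fin.any? (λ a → same? j v (f a))
    ... | no none = separated-cons sep⁺ (λ a t → none (a , same-pred t))
    ... | yes (a , va) with same? (suc j) v (f a)
    ...   | no ¬va = separated-cons sep⁺ (around a va ¬va)
    ...   | yes va' = separated-cons sep⁺ (around a (same-trans j (same-sym j s) va)
                        (λ wa' → ¬s' (same-trans (suc j) va' (same-sym (suc j) wa'))))

  separated-unstable : Fin n → ∀ m → (∀ j → j < m → ¬ Stable G j) →
    ∃ λ (g : Fin (suc m) → Fin n) → Separated m g
  separated-unstable v zero    _ = (λ _ → v) , λ { zero zero _ → refl }
  separated-unstable v (suc m) h =
    let _ , sep = separated-unstable v m (λ j j<m → h j (m≤n⇒m≤1+n j<m))
    in separated-suc sep (h m ≤-refl)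

  unstable⇒< : Fin n → ∀ m → (∀ j → j < m → ¬ Stable G j) → m < n
  unstable⇒< v m h =
    let _ , sep = separated-unstable v m h
    in Fin.injective⇒≤ (λ {a} {b} e → sep a b (subst (λ x → Same m _ x) e (same-refl m)))

isWL1-bound : ∀ {n} → 1 ≤ n → (G : Graph n) → ∀ m → IsWL1 G m → m ≤ n ∸ 1
isWL1-bound {suc n} _ G m (_ , h) = s≤s⁻¹ (Refinement.unstable⇒< G zero m h)

-- Stability persists, so instability at `n` covers all earlier rounds. Instability at `suc n` too
-- would give `2 + n` unstable rounds, more than `2 + n` vertices allow.
unstable⇒isWL1 : ∀ {n} (G : Graph (2 + n)) → ¬ Stable G n → IsWL1 G (suc n)
unstable⇒isWL1 {n} G ¬st = decidable-stable (stable? (suc n)) ¬¬st , before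
  where
  open Refinement G
  before : ∀ j → j < suc n → ¬ Stable G j
  before j j<1+n st = ¬st (stable-≤ (s≤s⁻¹ j<1+n) st)
  ¬¬st : ¬ ¬ Stable G (suc n)
  ¬¬st ¬st' = <-irrefl refl (unstable⇒< zero (2 + n) λ j j<2+n st → ¬st' (stable-≤ (s≤s⁻¹ j<2+n) st))

-- Graphs given by neighbour lists

_∈?_ : ∀ {n} (x : Fin n) (xs : List (Fin n)) → Dec (x ∈ xs)
_∈?_ = DecMembership._∈?_ Fin._≟_

T-does⁻ : ∀ {P : Set} (p? : Dec P) → T (does p?) → P
T-does⁻ (yes p) _ = p

T-does⁺ : ∀ {P : Set} (p? : Dec P) → P → T (does p?)
T-does⁺ (yes _) _ = _
T-does⁺ (no ¬p) p = contradiction p ¬p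

-- Both filtered lists are free of duplicates and have the same members, hence are permutations of
-- each other.
count-∈ : ∀ {n} (xs : List (Fin n)) → Unique xs → (p : Fin n → Bool) →
  count (λ y → does (y ∈? xs) ∧ p y) ≡ length (filter (T? ∘ p) xs)
count-∈ {n} xs unique p = ↭-length (∼bag⇒↭ (unique∧set⇒bag
  (Unique.filter⁺ (T? ∘ q) (Unique.allFin⁺ n)) (Unique.filter⁺ (T? ∘ p) unique) (mk⇔ forth back)))
  where
  q : Fin n → Bool
  q y = does (y ∈? xs) ∧ p y
  forth : ∀ {y} → y ∈ filter (T? ∘ q) (allFin n) → y ∈ filter (T? ∘ p) xs
  forth {y} y∈ = let _ , qy = ∈-filter⁻ (T? ∘ q) {xs = allFin n} y∈ ; a , b = to T-∧ qy
             in ∈-filter⁺ (T? ∘ p) (T-does⁻ (y ∈? xs) a) b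
  back : ∀ {y} → y ∈ filter (T? ∘ p) xs → y ∈ filter (T? ∘ q) (allFin n)
  back {y} y∈ = let a , b = ∈-filter⁻ (T? ∘ p) {xs = xs} y∈
            in ∈-filter⁺ (T? ∘ q) (∈-allFin y) (from T-∧ (T-does⁺ (y ∈? xs) a , b))

length-filter-pointwise : ∀ {A : Set} {R : A → A → Set} (p : A → Bool) →
  (∀ {x y} → R x y → p x ≡ p y) → ∀ {xs ys} → Pointwise R xs ys →
  length (filter (T? ∘ p) xs) ≡ length (filter (T? ∘ p) ys)
length-filter-pointwise p resp [] = refl
length-filter-pointwise p resp (_∷_ {x} {y} r rs) with p x | p y | resp r
... | true  | _ | refl = cong suc (length-filter-pointwise p resp rs)
... | false | _ | refl = length-filter-pointwise p resp rs

length-filter-true : ∀ {A : Set} (xs : List A) → length (filter (λ _ → T? true) xs) ≡ length xs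
length-filter-true []       = refl
length-filter-true (_ ∷ xs) = cong suc (length-filter-true xs)

count-≥ : ∀ {n} (p : Fin n → Bool) {xs} → Unique xs → All (T ∘ p) xs → length xs ≤ count (λ y → p y ∧ true)
count-≥ {n} p {xs} unique all =
  subst (_≤ _) (trans (count-∈ xs unique (λ _ → true)) (length-filter-true xs)) (mono (allFin n))
  where
  mono : ∀ ys → length (filter (λ y → T? (does (y ∈? xs) ∧ true)) ys) ≤ length (filter (λ y → T? (p y ∧ true)) ys)
  mono [] = z≤n
  mono (y ∷ ys) with y ∈? xs | p y in py
  ... | yes y∈ | true  = s≤s (mono ys)
  ... | yes y∈ | false = contradiction (subst T py (All.lookup all y∈)) λ ()
  ... | no _   | true  = m≤n⇒m≤1+n (mono ys)
  ... | no _   | false = mono ys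

-- Vertices may come from any type in bijection with `Fin n`, so that arguments about the graph can
-- proceed by pattern matching on structured vertices.
record Layout (n : ℕ) : Set₁ where
  field
    V          : Set
    vertices   : Fin n ↔ V
    nb         : V → List V
    nb-sym     : ∀ {v w} → w ∈ nb v → v ∈ nb w
    nb-irrefl  : ∀ v → v ∉ nb v
    nb-unique  : ∀ v → Unique (nb v)

  open Inverse vertices public renaming (to to vertex; from to index)

  vertex-index : ∀ v → vertex (index v) ≡ v
  vertex-index v = inverseˡ refl

  index-vertex : ∀ x → index (vertex x) ≡ x
  index-vertex x = inverseʳ refl

  index-injective : ∀ {v w} → index v ≡ index w → v ≡ w
  index-injective {v} {w} e = trans (sym (vertex-index v)) (trans (cong vertex e) (vertex-index w))

  neighbours : Fin n → List (Fin n)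
  neighbours x = map index (nb (vertex x))

  ∈-neighbours⁻ : ∀ {x y} → y ∈ neighbours x → vertex y ∈ nb (vertex x)
  ∈-neighbours⁻ y∈ with ∈-map⁻ index y∈
  ... | w , w∈ , refl rewrite vertex-index w = w∈

  ∈-neighbours⁺ : ∀ {x y} → vertex y ∈ nb (vertex x) → y ∈ neighbours x
  ∈-neighbours⁺ {x} {y} y∈ = subst (_∈ neighbours x) (index-vertex y) (∈-map⁺ index y∈)

  neighbours-sym : ∀ {x y} → y ∈ neighbours x → x ∈ neighbours y
  neighbours-sym = ∈-neighbours⁺ ∘ nb-sym ∘ ∈-neighbours⁻

  graph : Graph n
  graph = record
    { adj    = λ x y → does (y ∈? neighbours x)
    ; sym    = λ x y → does-⇔ (mk⇔ neighbours-sym neighbours-sym) (y ∈? neighbours x) (x ∈? neighbours y)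
    ; irrefl = λ x → dec-false (x ∈? neighbours x) (nb-irrefl (vertex x) ∘ ∈-neighbours⁻)
    }

  open Refinement graph

  nbrCount-filter : ∀ i x u →
    nbrCount i x u ≡ length (filter (λ y → T? (sameColour graph i y u)) (neighbours x))
  nbrCount-filter i x u = count-∈ (neighbours x) (Unique.map⁺ index-injective (nb-unique (vertex x))) _

  Alike : ℕ → V → V → Set
  Alike i v w = Same i (index v) (index w)

  private
    neighbours-index : ∀ v → neighbours (index v) ≡ map index (nb v)
    neighbours-index v = cong (map index ∘ nb) (vertex-index v)

    pointwise-index : ∀ {i xs ys} → Pointwise (Alike i) xs ys → Pointwise (Same i) (map index xs) (map index ys)
    pointwise-index [] = []
    pointwise-index (s ∷ ss) = s ∷ pointwise-index ss

  -- Equality of multisets follows from matching the two neighbour lists position by position, since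
  -- alike vertices lie in the same class and are counted together.
  alike-suc⁺ : ∀ {i v w} → Alike i v w → Pointwise (Alike i) (nb v) (nb w) → Alike (suc i) v w
  alike-suc⁺ {i} {v} {w} s ss = suc⁺ s λ u → trans (nbrCount-filter i (index v) u)
    (trans (length-filter-pointwise (λ y → sameColour graph i y u) (same-resp u)
             (subst₂ (Pointwise (Same i)) (sym (neighbours-index v)) (sym (neighbours-index w)) (pointwise-index ss)))
           (sym (nbrCount-filter i (index w) u)))
    where
    same-resp : ∀ u {x y} → Same i x y → sameColour graph i x u ≡ sameColour graph i y u
    same-resp u s = T-injective (λ t → holds (same-trans i (same-sym i s) (same t)))
                           (λ t → holds (same-trans i s (same t)))

  -- The class of `x` occurs equally often around `v` and `w`, and at least once around `v`, namely
  -- as `x` itself.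
  alike-nb : ∀ {i v w x} → Alike (suc i) v w → x ∈ nb v → ∃ λ y → y ∈ nb w × Alike i x y
  alike-nb {i} {v} {w} {x} s x∈ =
    let y , y∈ , yx = witness counts in y , y∈ , same-sym i yx
    where
    P? = λ y → T? (sameColour graph i y (index x))
    counts : length (filter P? (map index (nb v))) ≡ length (filter P? (map index (nb w)))
    counts = subst₂ (λ xs ys → length (filter P? xs) ≡ length (filter P? ys))
      (neighbours-index v) (neighbours-index w)
      (trans (sym (nbrCount-filter i (index v) (index x)))
        (trans (proj₂ (suc⁻ s) (index x)) (nbrCount-filter i (index w) (index x))))
    nonempty : ∀ {ys : List (Fin n)} → 0 < length ys → ∃ (_∈ ys)
    nonempty {y ∷ _} _ = y , here refl
    witness : length (filter P? (map index (nb v))) ≡ length (filter P? (map index (nb w))) →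
      ∃ λ y → y ∈ nb w × Alike i y x
    witness eq with nonempty (subst (0 <_) eq
                       (∈-length (∈-filter⁺ P? {xs = map index (nb v)} (∈-map⁺ index x∈) (holds (same-refl i)))))
    ... | z , z∈ with ∈-filter⁻ P? {xs = map index (nb w)} z∈
    ... | z∈' , zx with ∈-map⁻ index z∈'
    ... | y , y∈ , refl = y , y∈ , same zx

  nbrCount-zero : ∀ v u → nbrCount 0 (index v) u ≡ length (nb v)
  nbrCount-zero v u = trans (nbrCount-filter 0 (index v) u) (trans (length-filter-true (neighbours (index v)))
    (trans (length-map index (nb (vertex (index v)))) (cong (length ∘ nb) (vertex-index v))))

  -- All vertices have the same colour in round 0, so the counts behind round 1 are the degrees.
  alike-degree : ∀ {i v w} → Alike (suc i) v w → length (nb v) ≡ length (nb w)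
  alike-degree {i} {v} {w} s = trans (sym (nbrCount-zero v (index v)))
    (trans (proj₂ (suc⁻ (same-≤ (s≤s z≤n) s)) (index v)) (nbrCount-zero w (index v)))

-- The graphs

data Base : Set where
  fork cut : Base

data Top : Set where
  odd even : Top

data Arm : Set where
  L R Z : Arm

-- Only the base has an exceptional degree, 4 for `fork` and 2 for `cut` against 3 elsewhere; this
-- starts the wave. In a `fork` the two apexes carry both L and R, and the single tip carries both
-- vertices of the lowest pair of Z. In a `cut` every arm has its own pair of feet.
data BaseVertex : Base → Set where
  apex : Bool → BaseVertex fork
  tip  : BaseVertex fork
  foot : Arm → Bool → BaseVertex cut

-- There is one top pair for `odd`, joined to both R and Z, and there are two for `even`:
-- `cap false` on the R side and `cap true` on the Z side.
data TopVertex : Top → Set where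
  mid : Bool → TopVertex odd
  cap : Bool → Bool → TopVertex even

variable
  β : Base
  τ : Top
  K : ℕ

-- The position (i , j) on an arm lies i steps above its lowest and j steps below its highest pair.
data V (β : Base) (τ : Top) (K : ℕ) : Set where
  base : BaseVertex β → V β τ K
  arm  : Arm → (i j : ℕ) → .(i + j ≡ K) → Bool → V β τ K
  top  : TopVertex τ → V β τ K

lowest highest : Arm → Bool → V β τ K
lowest {K = K} a b  = arm a 0 K refl b
highest {K = K} a b = arm a K 0 (+-identityʳ K) b

footOf : Arm → Bool → BaseVertex β
footOf {fork} L b = apex b
footOf {fork} R b = apex b
footOf {fork} Z b = tip
footOf {cut}  a b = foot a b

down : Arm → (i j : ℕ) → .(i + j ≡ K) → Bool → V β τ K
down a zero    j e b = base (footOf a b)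
down a (suc i) j e b = arm a i (suc j) (trans (+-suc i j) e) b

-- The neighbours of a highest pair other than the one below it. Here the symmetry within L is
-- broken: `false` leads to the R side and `true` to the Z side. The height is a variable `i`
-- instead of `K`, which avoids transporting along `K + 0 ≡ K`.
crown : Arm → (i : ℕ) → .(i + 0 ≡ K) → Bool → List (V β τ K)
crown {τ = odd}  L i e false = arm R i 0 e false ∷ arm R i 0 e true ∷ []
crown {τ = odd}  L i e true  = arm Z i 0 e false ∷ arm Z i 0 e true ∷ []
crown {τ = odd}  R i e b     = top (mid b) ∷ arm L i 0 e false ∷ []
crown {τ = odd}  Z i e b     = top (mid b) ∷ arm L i 0 e true ∷ []
crown {τ = even} L i e b     = top (cap b false) ∷ top (cap b true) ∷ []
crown {τ = even} R i e b     = top (cap false b) ∷ arm R i 0 e (not b) ∷ []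
crown {τ = even} Z i e b     = top (cap true b) ∷ arm Z i 0 e (not b) ∷ []

up : Arm → (i j : ℕ) → .(i + j ≡ K) → Bool → List (V β τ K)
up a i zero    e b = crown a i e b
up a i (suc j) e b = arm a (suc i) j (trans (sym (+-suc i j)) e) b ∷ arm a i (suc j) e (not b) ∷ []

nb : V β τ K → List (V β τ K)
nb (base (apex b))     = lowest L b ∷ lowest R b ∷ base (apex (not b)) ∷ base tip ∷ []
nb (base tip)          = lowest Z false ∷ lowest Z true ∷ base (apex false) ∷ base (apex true) ∷ []
nb (base (foot L b))   = lowest L b ∷ base (foot R b) ∷ []
nb (base (foot R b))   = lowest R b ∷ base (foot L b) ∷ []
nb (base (foot Z b))   = lowest Z b ∷ base (foot Z (not b)) ∷ []
nb (arm a i j e b)     = down a i j e b ∷ up a i j e b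
nb (top (mid b))       = highest R b ∷ highest Z b ∷ top (mid (not b)) ∷ []
nb (top (cap false b)) = highest R b ∷ top (cap true b) ∷ highest L false ∷ []
nb (top (cap true b))  = highest Z b ∷ top (cap false b) ∷ highest L true ∷ []

arm-cong : ∀ {a i i' j j' b} .{e : i + j ≡ K} .{e' : i' + j' ≡ K} → i ≡ i' → j ≡ j' →
  arm {β} {τ} a i j e b ≡ arm a i' j' e' b
arm-cong refl refl = refl

-- Equality of naturals is decidable, so `recompute` recovers a usable proof from the irrelevant
-- one.
height-top : ∀ {i} → .(i + 0 ≡ K) → i ≡ K
height-top {K} {i} e = recompute (i ≟ K) (trans (sym (+-identityʳ i)) e)

arm-lowest : ∀ {a j b} .{e : 0 + j ≡ K} → arm {β} {τ} a 0 j e b ≡ lowest a b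
arm-lowest {K} {j = j} {e = e} = arm-cong refl (recompute (j ≟ K) e)

arm-highest : ∀ {a i b} .{e : i + 0 ≡ K} → arm {β} {τ} a i 0 e b ≡ highest a b
arm-highest {e = e} = arm-cong (height-top e) refl

lowest∈ : ∀ {a i b} .{e : 0 + i ≡ K} {xs : List (V β τ K)} → lowest a b ∈ xs → arm a 0 i e b ∈ xs
lowest∈ {xs = xs} = subst (_∈ xs) (sym arm-lowest)

∈up-lowest : ∀ {a b} → arm {β} {τ} {K} a 0 K refl b ∈ nb (base (footOf a b))
∈up-lowest {fork} {a = L} = here refl
∈up-lowest {fork} {a = R} = there (here refl)
∈up-lowest {fork} {a = Z} {false} = here refl
∈up-lowest {fork} {a = Z} {true}  = there (here refl)
∈up-lowest {cut}  {a = L} = here refl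
∈up-lowest {cut}  {a = R} = here refl
∈up-lowest {cut}  {a = Z} = here refl

crown-sym : ∀ {a i b} .{e : i + 0 ≡ K} {w : V β τ K} → w ∈ crown a i e b → arm a i 0 e b ∈ nb w
crown-sym {τ = odd} {L} {b = false} (here refl)         = there (there (here refl))
crown-sym {τ = odd} {L} {b = false} (there (here refl)) = there (there (here refl))
crown-sym {τ = odd} {L} {b = true}  (here refl)         = there (there (here refl))
crown-sym {τ = odd} {L} {b = true}  (there (here refl)) = there (there (here refl))
crown-sym {τ = odd} {R} (here refl)         = here arm-highest
crown-sym {τ = odd} {R} {b = false} (there (here refl)) = there (here refl)
crown-sym {τ = odd} {R} {b = true}  (there (here refl)) = there (there (here refl))
crown-sym {τ = odd} {Z} (here refl)         = there (here arm-highest)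
crown-sym {τ = odd} {Z} {b = false} (there (here refl)) = there (here refl)
crown-sym {τ = odd} {Z} {b = true}  (there (here refl)) = there (there (here refl))
crown-sym {τ = even} {L} {b = false} (here refl)         = there (there (here arm-highest))
crown-sym {τ = even} {L} {b = false} (there (here refl)) = there (there (here arm-highest))
crown-sym {τ = even} {L} {b = true}  (here refl)         = there (there (here arm-highest))
crown-sym {τ = even} {L} {b = true}  (there (here refl)) = there (there (here arm-highest))
crown-sym {τ = even} {R} (here refl)         = here arm-highest
crown-sym {τ = even} {R} {b = false} (there (here refl)) = there (there (here refl))
crown-sym {τ = even} {R} {b = true}  (there (here refl)) = there (there (here refl))
crown-sym {τ = even} {Z} (here refl)         = here arm-highest
crown-sym {τ = even} {Z} {b = false} (there (here refl)) = there (there (here refl))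
crown-sym {τ = even} {Z} {b = true}  (there (here refl)) = there (there (here refl))

nb-sym : ∀ {v w : V β τ K} → w ∈ nb v → v ∈ nb w
nb-sym {v = base (apex b)} (here refl)                                 = here refl
nb-sym {v = base (apex b)} (there (here refl))                         = here refl
nb-sym {v = base (apex false)} (there (there (here refl)))             = there (there (here refl))
nb-sym {v = base (apex true)}  (there (there (here refl)))             = there (there (here refl))
nb-sym {v = base (apex false)} (there (there (there (here refl))))     = there (there (here refl))
nb-sym {v = base (apex true)}  (there (there (there (here refl))))     = there (there (there (here refl)))
nb-sym {v = base tip} (here refl)                                      = here refl
nb-sym {v = base tip} (there (here refl))                              = here refl
nb-sym {v = base tip} (there (there (here refl)))                      = there (there (there (here refl)))
nb-sym {v = base tip} (there (there (there (here refl))))              = there (there (there (here refl)))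
nb-sym {v = base (foot L b)} (here refl)                               = here refl
nb-sym {v = base (foot L b)} (there (here refl))                       = there (here refl)
nb-sym {v = base (foot R b)} (here refl)                               = here refl
nb-sym {v = base (foot R b)} (there (here refl))                       = there (here refl)
nb-sym {v = base (foot Z b)} (here refl)                               = here refl
nb-sym {v = base (foot Z false)} (there (here refl))                   = there (here refl)
nb-sym {v = base (foot Z true)}  (there (here refl))                   = there (here refl)
nb-sym {v = arm a zero j e b} (here refl)                              = lowest∈ ∈up-lowest
nb-sym {v = arm a (suc i) j e b} (here refl)                           = there (here refl)
nb-sym {v = arm a i zero e b} (there w∈)                               = crown-sym w∈
nb-sym {v = arm a i (suc j) e b} (there (here refl))                   = here refl
nb-sym {v = arm a i (suc j) e false} (there (there (here refl)))       = there (there (here refl))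
nb-sym {v = arm a i (suc j) e true}  (there (there (here refl)))       = there (there (here refl))
nb-sym {v = top (mid b)} (here refl)                                   = there (here refl)
nb-sym {v = top (mid b)} (there (here refl))                           = there (here refl)
nb-sym {v = top (mid false)} (there (there (here refl)))               = there (there (here refl))
nb-sym {v = top (mid true)}  (there (there (here refl)))               = there (there (here refl))
nb-sym {v = top (cap false b)} (here refl)                             = there (here refl)
nb-sym {v = top (cap false b)} (there (here refl))                     = there (here refl)
nb-sym {v = top (cap false false)} (there (there (here refl)))         = there (here refl)
nb-sym {v = top (cap false true)}  (there (there (here refl)))         = there (there (here refl))
nb-sym {v = top (cap true b)} (here refl)                              = there (here refl)
nb-sym {v = top (cap true b)} (there (here refl))                      = there (here refl)
nb-sym {v = top (cap true false)} (there (there (here refl)))          = there (here refl)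
nb-sym {v = top (cap true true)}  (there (there (here refl)))          = there (there (here refl))

crown-irrefl : ∀ {a i b} .{e : i + 0 ≡ K} → arm {β} {τ} a i 0 e b ∉ crown a i e b
crown-irrefl {τ = odd} {L} {b = false} (here ())
crown-irrefl {τ = odd} {L} {b = false} (there (here ()))
crown-irrefl {τ = odd} {L} {b = true}  (here ())
crown-irrefl {τ = odd} {L} {b = true}  (there (here ()))
crown-irrefl {τ = odd} {R} (there (here ()))
crown-irrefl {τ = odd} {Z} (there (here ()))
crown-irrefl {τ = even} {L} (there (here ()))
crown-irrefl {τ = even} {R} {b = false} (there (here ()))
crown-irrefl {τ = even} {R} {b = true}  (there (here ()))
crown-irrefl {τ = even} {Z} {b = false} (there (here ()))
crown-irrefl {τ = even} {Z} {b = true}  (there (here ()))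

nb-irrefl : (v : V β τ K) → v ∉ nb v
nb-irrefl (base (apex false)) (there (there (here ())))
nb-irrefl (base (apex true))  (there (there (here ())))
nb-irrefl (base (apex false)) (there (there (there (here ()))))
nb-irrefl (base (apex true))  (there (there (there (here ()))))
nb-irrefl (base tip) (there (there (there (here ()))))
nb-irrefl (base (foot L b)) (there (here ()))
nb-irrefl (base (foot R b)) (there (here ()))
nb-irrefl (base (foot Z false)) (there (here ()))
nb-irrefl (base (foot Z true))  (there (here ()))
nb-irrefl (arm a zero j e b) (here ())
nb-irrefl (arm a (suc i) j e b) (here ())
nb-irrefl (arm a i zero e b) (there v∈) = crown-irrefl v∈
nb-irrefl (arm a i (suc j) e b) (there (here ()))
nb-irrefl (arm a i (suc j) e false) (there (there (here ())))
nb-irrefl (arm a i (suc j) e true)  (there (there (here ())))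
nb-irrefl (top (mid false)) (there (there (here ())))
nb-irrefl (top (mid true))  (there (there (here ())))
nb-irrefl (top (cap false b)) (there (there (here ())))
nb-irrefl (top (cap true b))  (there (there (here ())))

pair-unique : ∀ {A : Set} {x y : A} → x ≢ y → Unique (x ∷ y ∷ [])
pair-unique x≢y = (x≢y ∷ []) ∷ [] ∷ []

triple-unique : ∀ {A : Set} {x y z : A} → x ≢ y → x ≢ z → y ≢ z → Unique (x ∷ y ∷ z ∷ [])
triple-unique x≢y x≢z y≢z = (x≢y ∷ x≢z ∷ []) ∷ pair-unique y≢z

down-crown-unique : ∀ {a i b} .{e : i + 0 ≡ K} → Unique (down {β = β} {τ = τ} a i 0 e b ∷ crown a i e b)
down-crown-unique {τ = odd} {L} {zero}  {false} = triple-unique (λ ()) (λ ()) (λ ())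
down-crown-unique {τ = odd} {L} {suc i} {false} = triple-unique (λ ()) (λ ()) (λ ())
down-crown-unique {τ = odd} {L} {zero}  {true}  = triple-unique (λ ()) (λ ()) (λ ())
down-crown-unique {τ = odd} {L} {suc i} {true}  = triple-unique (λ ()) (λ ()) (λ ())
down-crown-unique {τ = odd} {R} {zero}  = triple-unique (λ ()) (λ ()) (λ ())
down-crown-unique {τ = odd} {R} {suc i} = triple-unique (λ ()) (λ ()) (λ ())
down-crown-unique {τ = odd} {Z} {zero}  = triple-unique (λ ()) (λ ()) (λ ())
down-crown-unique {τ = odd} {Z} {suc i} = triple-unique (λ ()) (λ ()) (λ ())
down-crown-unique {τ = even} {L} {zero}  = triple-unique (λ ()) (λ ()) (λ ())
down-crown-unique {τ = even} {L} {suc i} = triple-unique (λ ()) (λ ()) (λ ())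
down-crown-unique {τ = even} {R} {zero}  = triple-unique (λ ()) (λ ()) (λ ())
down-crown-unique {τ = even} {R} {suc i} = triple-unique (λ ()) (λ ()) (λ ())
down-crown-unique {τ = even} {Z} {zero}  = triple-unique (λ ()) (λ ()) (λ ())
down-crown-unique {τ = even} {Z} {suc i} = triple-unique (λ ()) (λ ()) (λ ())

nb-unique : (v : V β τ K) → Unique (nb v)
nb-unique (base (apex b))   = ((λ ()) ∷ (λ ()) ∷ (λ ()) ∷ []) ∷ triple-unique (λ ()) (λ ()) (λ ())
nb-unique (base tip)        = ((λ ()) ∷ (λ ()) ∷ (λ ()) ∷ []) ∷ triple-unique (λ ()) (λ ()) (λ ())
nb-unique (base (foot L b)) = pair-unique (λ ())
nb-unique (base (foot R b)) = pair-unique (λ ())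
nb-unique (base (foot Z b)) = pair-unique (λ ())
nb-unique (arm a i zero e b)          = down-crown-unique
nb-unique (arm a zero (suc j) e b)    = triple-unique (λ ()) (λ ()) (λ ())
nb-unique (arm a (suc i) (suc j) e b) = triple-unique (λ ()) (λ ()) (λ ())
nb-unique (top (mid b))       = triple-unique (λ ()) (λ ()) (λ ())
nb-unique (top (cap false b)) = triple-unique (λ ()) (λ ()) (λ ())
nb-unique (top (cap true b))  = triple-unique (λ ()) (λ ()) (λ ())

-- Enumeration of the vertices

baseSize : Base → ℕ
baseSize fork = 3
baseSize cut  = 6

topSize : Top → ℕ
topSize odd  = 2
topSize even = 4

size : Base → Top → ℕ → ℕ
size β τ K = baseSize β + (3 * (suc K * 2) + topSize τ)

arms : Fin 3 ↔ Arm
arms = mk↔ₛ′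
  (λ { zero → L ; (suc zero) → R ; (suc (suc zero)) → Z })
  (λ { L → zero ; R → suc zero ; Z → suc (suc zero) })
  (λ { L → refl ; R → refl ; Z → refl })
  (λ { zero → refl ; (suc zero) → refl ; (suc (suc zero)) → refl })

baseVertices : Fin (baseSize β) ↔ BaseVertex β
baseVertices {fork} = mk↔ₛ′
  (λ { zero → tip ; (suc zero) → apex false ; (suc (suc zero)) → apex true })
  (λ { tip → zero ; (apex false) → suc zero ; (apex true) → suc (suc zero) })
  (λ { tip → refl ; (apex false) → refl ; (apex true) → refl })
  (λ { zero → refl ; (suc zero) → refl ; (suc (suc zero)) → refl })
baseVertices {cut} = ↔-trans (*↔× {3} {2}) (↔-trans (arms ×-↔ 2↔Bool)
  (mk↔ₛ′ (λ (a , b) → foot a b) (λ { (foot a b) → a , b }) (λ { (foot a b) → refl }) (λ { (a , b) → refl })))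

topVertices : Fin (topSize τ) ↔ TopVertex τ
topVertices {odd} = ↔-trans 2↔Bool (mk↔ₛ′ mid (λ { (mid b) → b }) (λ { (mid b) → refl }) (λ _ → refl))
topVertices {even} = ↔-trans (*↔× {2} {2}) (↔-trans (2↔Bool ×-↔ 2↔Bool)
  (mk↔ₛ′ (λ (a , b) → cap a b) (λ { (cap a b) → a , b }) (λ { (cap a b) → refl }) (λ { (a , b) → refl })))

parts : (BaseVertex β ⊎ ((Arm × (Fin (suc K) × Bool)) ⊎ TopVertex τ)) ↔ V β τ K
parts {β} {K} {τ} = mk↔ₛ′ join split join∘split split∘join
  where
  join : BaseVertex β ⊎ ((Arm × (Fin (suc K) × Bool)) ⊎ TopVertex τ) → V β τ K
  join (inj₁ v)                     = base v
  join (inj₂ (inj₁ (a , (i , b)))) = arm a (toℕ i) (K ∸ toℕ i) (m+[n∸m]≡n (toℕ≤pred[n] i)) b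
  join (inj₂ (inj₂ v))              = top v

  height< : ∀ {i j} → i + j ≡ K → i < suc K
  height< {i} {j} refl = s≤s (m≤m+n i j)

  split : V β τ K → BaseVertex β ⊎ ((Arm × (Fin (suc K) × Bool)) ⊎ TopVertex τ)
  split (base v)        = inj₁ v
  split (arm a i j e b) = inj₂ (inj₁ (a , (fromℕ< (height< {i} {j} e) , b)))
  split (top v)         = inj₂ (inj₂ v)

  depth≡ : ∀ {i j} → i + j ≡ K → (i<1+K : i < suc K) → K ∸ toℕ (fromℕ< i<1+K) ≡ j
  depth≡ {i} {j} refl i<1+K = trans (cong (i + j ∸_) (toℕ-fromℕ< i<1+K)) (m+n∸m≡n i j)

  join∘split : ∀ v → join (split v) ≡ v
  join∘split (base v)        = refl
  join∘split (arm a i j e b) = arm-cong (toℕ-fromℕ< (height< {i} {j} e))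
    (recompute (K ∸ toℕ (fromℕ< (height< {i} {j} e)) ≟ j) (depth≡ {i} {j} e (height< {i} {j} e)))
  join∘split (top v)         = refl

  split∘join : ∀ x → split (join x) ≡ x
  split∘join (inj₁ v)                    = refl
  split∘join (inj₂ (inj₁ (a , (i , b)))) = cong (λ i → inj₂ (inj₁ (a , (i , b)))) (fromℕ<-toℕ i _)
  split∘join (inj₂ (inj₂ v))             = refl

snake : ∀ β τ K → Layout (size β τ K)
snake β τ K = record
  { V         = V β τ K
  ; vertices  = ↔-trans +↔⊎ (↔-trans (baseVertices ⊎-↔ ↔-trans +↔⊎
                  (↔-trans *↔× (arms ×-↔ ↔-trans *↔× (↔-refl ×-↔ 2↔Bool)) ⊎-↔ topVertices)) parts)
  ; nb        = nb
  ; nb-sym    = nb-sym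
  ; nb-irrefl = nb-irrefl
  ; nb-unique = nb-unique
  }

-- Bounds on the progress of the refinement

-- flip, swap and fold pair up vertices that the refinement confuses for some time. It first separates the levels,
-- then every v from fold v, then every v from swap v and finally every v from flip v.
flip swap fold : V β τ K → V β τ K
flip (base (apex b))   = base (apex (not b))
flip (base tip)        = base tip
flip (base (foot a b)) = base (foot a (not b))
flip (arm a i j e b)   = arm a i j e (not b)
flip (top (mid b))     = top (mid (not b))
flip (top (cap s b))   = top (cap s (not b))

swap (base (foot R b))   = base (foot Z b)
swap (arm R i j e b)     = arm Z i j e b
swap (top (cap false b)) = top (cap true b)
swap v = v

fold (base (apex b))   = base tip
fold (base (foot L b)) = base (foot R b)
fold (arm L i j e b)   = arm R i j e b
fold v = v

level depth pathIndex : V β τ K → ℕ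
level (base _)          = 0
level (arm _ i _ _ _)   = suc i
level {K = K} (top _)   = 2 + K

depth (arm L _ j _ _) = j
-- This is the true depth of the base pair below L; every other vertex covered here is fixed by
-- `fold`.
depth {K = K} _       = suc K

-- `offsetR` and `offsetZ` are the path positions of the lowest pair of R and of the highest pair of
-- Z. Between L and R the path passes one base pair for `fork` and two for `cut`; between R and Z it
-- passes one top pair for `odd` and two for `even`.
offsetR : Base → ℕ → ℕ
offsetR fork K = 2 + K
offsetR cut  K = 3 + K

offsetZ : Base → Top → ℕ → ℕ
offsetZ β odd  K = 2 + (K + offsetR β K)
offsetZ β even K = 3 + (K + offsetR β K)

-- The position of a pair on the path along which the pairs are split at the end. The value at tip is irrelevant.
pathIndex {K = K} (base (apex _))                 = suc K
pathIndex {K = K} (base (foot L _))               = suc K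
pathIndex {K = K} (base (foot R _))               = 2 + K
pathIndex {β} {τ} {K} (base (foot Z _))           = suc (K + offsetZ β τ K)
pathIndex {β} {τ} {K} (base tip)                  = suc (K + offsetZ β τ K)
pathIndex (arm L _ j _ _)                         = j
pathIndex {β} {K = K} (arm R i _ _ _)             = i + offsetR β K
pathIndex {β} {τ} {K} (arm Z _ j _ _)             = j + offsetZ β τ K
pathIndex {β} {K = K} (top (mid _))               = suc (K + offsetR β K)
pathIndex {β} {K = K} (top (cap false _))         = suc (K + offsetR β K)
pathIndex {β} {K = K} (top (cap true _))          = 2 + (K + offsetR β K)

depth≤ : ∀ {i j} → .(i + j ≡ K) → j ≤ K
depth≤ {K} {i} {j} e = subst (j ≤_) (recompute (i + j ≟ K) e) (m≤n+m j i)

-- One round, starting from an abstract relation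

Relation : Base → Top → ℕ → Set₁
Relation β τ K = V β τ K → V β τ K → Set

module _ (E : Relation β τ K) where

  -- `E` stands for having equal colours in a fixed round. These are the invariants of the four
  -- phases; the threshold grows by one per round, as the confusion that remains shrinks.
  FlipFrom SwapFrom FoldFrom Capped : ℕ → Set
  FlipFrom p = ∀ v → p ≤ pathIndex v → E v (flip v)
  SwapFrom s = ∀ v → s ≤ level v → E v (swap v)
  FoldFrom q = ∀ v → q ≤ depth v → E v (fold v)
  Capped p   = ∀ v w → level v ⊓ p ≡ level w ⊓ p → E v w

  -- The neighbour lists are ordered such that they can always be matched in the given order.
  Next : V β τ K → V β τ K → Set
  Next v w = Pointwise E (nb v) (nb w)

-- The level at which the two vertices of the highest pair of L see the R side and the Z side: the
-- highest pairs of the arms for `odd`, the caps for `even`.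
crownLevel : Top → ℕ → ℕ
crownLevel odd  K = 1 + K
crownLevel even K = 2 + K

-- Flipping the highest pair of L exchanges neighbours on the R side for neighbours on the Z side.
-- Hence this pair needs swaps, and it is the first to split.
crown-flip : {E : Relation β τ K} → SwapFrom E (crownLevel τ K) →
  (∀ {x y} → E x y → E y x) →
  ∀ {i b} .{e : i + 0 ≡ K} → Pointwise E (crown L i e b) (crown L i e (not b))
crown-flip {τ = odd} s E-sym {i} {false} {e} = s _ i≤ ∷ s _ i≤ ∷ []
  where i≤ = ≤-reflexive (cong suc (sym (height-top e)))
crown-flip {τ = odd} s E-sym {i} {true} {e} = E-sym (s _ i≤) ∷ E-sym (s _ i≤) ∷ []
  where i≤ = ≤-reflexive (cong suc (sym (height-top e)))
crown-flip {τ = even} s E-sym {b = false} = s _ ≤-refl ∷ s _ ≤-refl ∷ []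
crown-flip {τ = even} s E-sym {b = true}  = E-sym (s _ ≤-refl) ∷ E-sym (s _ ≤-refl) ∷ []

crown-flip-R : {E : Relation β τ K} (p p' : ℕ) → (∀ {m} → p' ≤ suc m → p ≤ m) → FlipFrom E p →
  (∀ {x} → E x x) → ∀ {i b} .{e : i + 0 ≡ K} → p' ≤ i + offsetR β K →
  Pointwise E (crown R i e b) (crown R i e (not b))
crown-flip-R {τ = odd} p p' near f E-refl {e = e} h =
  f _ (near (≤-trans h (m≤n⇒m≤1+n (m≤n⇒m≤1+n (≤-reflexive (cong (_+ _) (height-top e))))))) ∷ E-refl ∷ []
crown-flip-R {τ = even} p p' near f E-refl {e = e} h =
  f _ (near (≤-trans h (m≤n⇒m≤1+n (m≤n⇒m≤1+n (≤-reflexive (cong (_+ _) (height-top e))))))) ∷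
  f _ (near (m≤n⇒m≤1+n h)) ∷ []

crown-flip-Z : {E : Relation β τ K} (p p' : ℕ) → (∀ {m} → p' ≤ suc m → p ≤ m) → FlipFrom E p →
  (∀ {x} → E x x) → ∀ {i b} .{e : i + 0 ≡ K} → p' ≤ offsetZ β τ K →
  Pointwise E (crown Z i e b) (crown Z i e (not b))
crown-flip-Z {τ = odd} p p' near f E-refl h = f _ (near h) ∷ E-refl ∷ []
crown-flip-Z {τ = even} p p' near f E-refl h = f _ (near h) ∷ f _ (near (m≤n⇒m≤1+n h)) ∷ []

-- Used with p = p' = 0 while no pair is split, and with p' = suc p once the pairs before position p are split.
flip-next : {E : Relation β τ K} → IsEquivalence E → (p p' : ℕ) → (∀ {m} → p' ≤ suc m → p ≤ m) →
  (p' ≤ 0 → SwapFrom E (crownLevel τ K)) → FlipFrom E p → ∀ v → p' ≤ pathIndex v → Next E v (flip v)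
flip-next {β} {τ} {K} {E} equiv p p' near swaps f = go
  where
  open IsEquivalence equiv using () renaming (refl to E-refl; sym to E-sym)

  by : ∀ {n} x → p' ≤ n → n ≤ suc (pathIndex x) → E x (flip x)
  by x h le = f x (near (≤-trans h le))

  -- β cannot be matched on here, but matching β' and refl instantiates it.
  down-flip-R : ∀ {β'} (eq : β' ≡ β) i {j b} .{e : i + j ≡ K} → p' ≤ i + offsetR β K →
    E (down R i j e b) (down R i j e (not b))
  down-flip-R {fork} refl zero    h = by _ h ≤-refl
  down-flip-R {cut}  refl zero    h = by _ h ≤-refl
  down-flip-R refl (suc i) h = by _ h ≤-refl

  down-flip-L : ∀ {β'} (eq : β' ≡ β) i {j b} .{e : i + j ≡ K} → p' ≤ j →
    E (down L i j e b) (down L i j e (not b))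
  down-flip-L {fork} refl zero {e = e}    h = by _ h (m≤n⇒m≤1+n (m≤n⇒m≤1+n (depth≤ {i = 0} e)))
  down-flip-L {cut}  refl zero {e = e}    h = by _ h (m≤n⇒m≤1+n (m≤n⇒m≤1+n (depth≤ {i = 0} e)))
  down-flip-L refl (suc i) h = by _ h (m≤n⇒m≤1+n (n≤1+n _))

  down-flip-Z : ∀ {β'} (eq : β' ≡ β) i {j b} .{e : i + j ≡ K} → p' ≤ j + offsetZ β τ K →
    E (down Z i j e b) (down Z i j e (not b))
  -- Both vertices of the lowest pair of Z stand on the tip, so in a `fork` the path ends here.
  down-flip-Z {fork} refl zero h = E-refl
  down-flip-Z {cut}  refl zero {e = e} h = by _ h (m≤n⇒m≤1+n (m≤n⇒m≤1+n (+-monoˡ-≤ _ (depth≤ {i = 0} e))))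
  down-flip-Z refl (suc i) h = by _ h (m≤n⇒m≤1+n (n≤1+n _))

  go : ∀ v → p' ≤ pathIndex v → Next E v (flip v)
  go (base (apex b)) h = by _ h ≤-refl ∷ by _ h (s≤s (≤-trans (n≤1+n K) (n≤1+n _))) ∷ by _ h (n≤1+n _) ∷ E-refl ∷ []
  go (base tip) h = Pointwise.refl E-refl
  go (base (foot L b)) h = by _ h ≤-refl ∷ by _ h (m≤n⇒m≤1+n (n≤1+n _)) ∷ []
  go (base (foot R b)) h = by _ h (m≤n⇒m≤1+n (n≤1+n _)) ∷ by _ h ≤-refl ∷ []
  go (base (foot Z b)) h = by _ h ≤-refl ∷ by _ h (n≤1+n _) ∷ []
  go (arm L i zero e b) h = down-flip-L refl i h ∷ crown-flip (swaps h) E-sym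
  go (arm L i (suc j) e b) h = down-flip-L refl i h ∷ by _ h ≤-refl ∷ by _ h (n≤1+n _) ∷ []
  go (arm R i zero e b) h = down-flip-R refl i h ∷ crown-flip-R p p' near f E-refl h
  go (arm R i (suc j) e b) h = down-flip-R refl i h ∷ by _ h (m≤n⇒m≤1+n (n≤1+n _)) ∷ by _ h (n≤1+n _) ∷ []
  go (arm Z i zero e b) h = down-flip-Z refl i h ∷ crown-flip-Z p p' near f E-refl h
  go (arm Z i (suc j) e b) h = down-flip-Z refl i h ∷ by _ h ≤-refl ∷ by _ h (n≤1+n _) ∷ []
  go (top (mid b)) h = by _ h ≤-refl ∷ by _ h (m≤n⇒m≤1+n (n≤1+n _)) ∷ by _ h (n≤1+n _) ∷ []
  go (top (cap false b)) h = by _ h ≤-refl ∷ by _ h (m≤n⇒m≤1+n (n≤1+n _)) ∷ E-refl ∷ []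
  go (top (cap true b)) h = by _ h (m≤n⇒m≤1+n (n≤1+n _)) ∷ by _ h ≤-refl ∷ E-refl ∷ []

-- Between apex and tip there is nothing to swap, so with the base fork the swaps start to break at level 1.
swapStart : Base → ℕ
swapStart fork = 1
swapStart cut  = 0

crown-swap : {E : Relation β τ K} → IsEquivalence E → FlipFrom E 0 →
  ∀ {i b} .{e : i + 0 ≡ K} → SwapFrom E (suc i) → Pointwise E (crown R i e b) (crown Z i e b)
crown-swap {τ = odd} equiv f s = IsEquivalence.refl equiv ∷ f _ z≤n ∷ []
crown-swap {τ = even} equiv f {i} {e = e} s =
  s _ (≤-trans (≤-reflexive (cong suc (height-top e))) (n≤1+n _)) ∷ s _ ≤-refl ∷ []

-- R and Z differ through the base, where R is linked to L and Z is not; `feet` hides this as long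
-- as it is required. At the top, swapping amounts to flipping vertices of L, whence `FlipFrom E 0`.
-- The roles of `s` and `s'` are those of `p` and `p'` in `flip-next`.
swap-next : {E : Relation β τ K} → IsEquivalence E → (s s' : ℕ) → (∀ {m} → s' ≤ suc m → s ≤ m) →
  FlipFrom E 0 → (s' ≤ swapStart β → ∀ b → E (base (footOf L b)) (base (footOf Z b))) →
  SwapFrom E s → ∀ v → s' ≤ level v → Next E v (swap v)
swap-next {β} {τ} {K} {E} equiv s s' near flips feet sw = go
  where
  open IsEquivalence equiv using () renaming (refl to E-refl; sym to E-sym; trans to E-trans)

  by : ∀ {n} x → s' ≤ n → n ≤ suc (level x) → E x (swap x)
  by x h le = sw x (near (≤-trans h le))

  down-swap : ∀ {β'} (eq : β' ≡ β) i {j b} .{e : i + j ≡ K} → s' ≤ suc i →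
    E (down R i j e b) (down Z i j e b)
  down-swap {fork} refl zero h = feet h _
  down-swap {cut} refl zero h = by _ h ≤-refl
  down-swap refl (suc i) h = by _ h ≤-refl

  go : ∀ v → s' ≤ level v → Next E v (swap v)
  go (base (apex b)) h = Pointwise.refl E-refl
  go (base tip) h = Pointwise.refl E-refl
  go (base (foot L b)) h = Pointwise.refl E-refl
  go (base (foot R b)) h = by _ h z≤n ∷ E-trans (feet h b) (flips _ z≤n) ∷ []
  go (base (foot Z b)) h = Pointwise.refl E-refl
  go (arm L i j e b) h = Pointwise.refl E-refl
  go (arm R i zero e b) h = down-swap refl i h ∷
    crown-swap equiv flips (λ v le → sw v (near (m≤n⇒m≤1+n (≤-trans h le))))
  go (arm R i (suc j) e b) h = down-swap refl i h ∷ by _ h (m≤n⇒m≤1+n (n≤1+n _)) ∷ by _ h (n≤1+n _) ∷ []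
  go (arm Z i j e b) h = Pointwise.refl E-refl
  go (top (mid b)) h = Pointwise.refl E-refl
  go (top (cap false b)) h = by _ h ≤-refl ∷ E-sym (by _ h (n≤1+n _)) ∷ flips _ z≤n ∷ []
  go (top (cap true b)) h = Pointwise.refl E-refl

-- The difference between L and the other arms comes from the top and descends one step per round:
-- neighbours of a vertex at depth `suc q` have depth at least `q`. At the base a fold may have to
-- be composed with swaps and flips.
fold-next : {E : Relation β τ K} → IsEquivalence E → (q : ℕ) →
  FlipFrom E 0 → SwapFrom E 0 → FoldFrom E q → ∀ v → suc q ≤ depth v → Next E v (fold v)
fold-next {β} {τ} {K} {E} equiv q flips swaps f = go
  where
  open IsEquivalence equiv using () renaming (refl to E-refl; sym to E-sym; trans to E-trans)

  flipped : ∀ x → E x (flip x)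
  flipped x = flips x z≤n

  swapped : ∀ x → E x (swap x)
  swapped x = swaps x z≤n

  down-fold : ∀ {β'} (eq : β' ≡ β) i {j b} .{e : i + j ≡ K} → q ≤ j → E (down L i j e b) (down R i j e b)
  down-fold {fork} refl zero h = E-refl
  down-fold {cut} refl zero {e = e} h = f _ (≤-trans h (m≤n⇒m≤1+n (depth≤ {i = 0} e)))
  down-fold refl (suc i) h = f _ (m≤n⇒m≤1+n h)

  go : ∀ v → suc q ≤ depth v → Next E v (fold v)
  go (base (apex false)) (s≤s h) =
    E-trans (f _ h) (swapped _) ∷ E-trans (swapped _) (flipped _) ∷ flipped _ ∷ E-sym (f _ (m≤n⇒m≤1+n h)) ∷ []
  go (base (apex true)) (s≤s h) =
    E-trans (f _ h) (E-trans (swapped _) (flipped _)) ∷ swapped _ ∷ E-refl ∷ E-sym (f _ (m≤n⇒m≤1+n h)) ∷ []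
  go (base tip) h = Pointwise.refl E-refl
  go (base (foot L b)) (s≤s h) = f _ h ∷ E-sym (f _ (m≤n⇒m≤1+n h)) ∷ []
  go (base (foot R b)) h = Pointwise.refl E-refl
  go (base (foot Z b)) h = Pointwise.refl E-refl
  go (arm L i (suc j) e b) (s≤s h) = down-fold refl i (m≤n⇒m≤1+n h) ∷ f _ h ∷ f _ (m≤n⇒m≤1+n h) ∷ []
  go (arm R i j e b) h = Pointwise.refl E-refl
  go (arm Z i j e b) h = Pointwise.refl E-refl
  go (top (mid b)) h = Pointwise.refl E-refl
  go (top (cap false b)) h = Pointwise.refl E-refl
  go (top (cap true b)) h = Pointwise.refl E-refl

-- The levels of the neighbours of a vertex, if the levels 1 + K and 2 + K are identified.
baseProfile : Base → List ℕ
baseProfile fork = 1 ∷ 1 ∷ 0 ∷ 0 ∷ []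
baseProfile cut  = 1 ∷ 0 ∷ []

profile : Base → ℕ → List ℕ
profile β zero    = baseProfile β
profile β (suc i) = i ∷ 2 + i ∷ 1 + i ∷ []

crown-profile : ∀ {a i b} .{e : i + 0 ≡ K} →
  map (λ x → level x ⊓ suc K) (crown {β = β} {τ = τ} a i e b) ≡ map (_⊓ suc K) (2 + i ∷ 1 + i ∷ [])
crown-profile {τ = odd} {a = L} {i} {false} {e} with refl ← height-top {i = i} e =
  cong (λ m → suc m ∷ suc (i ⊓ i) ∷ []) (trans (⊓-idem i) (sym (m≥n⇒m⊓n≡n (n≤1+n i))))
crown-profile {τ = odd} {a = L} {i} {true} {e} with refl ← height-top {i = i} e =
  cong (λ m → suc m ∷ suc (i ⊓ i) ∷ []) (trans (⊓-idem i) (sym (m≥n⇒m⊓n≡n (n≤1+n i))))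
crown-profile {τ = odd} {a = R} {i} {e = e} with refl ← height-top {i = i} e = refl
crown-profile {τ = odd} {a = Z} {i} {e = e} with refl ← height-top {i = i} e = refl
crown-profile {τ = even} {a = L} {i} {e = e} with refl ← height-top {i = i} e =
  cong (λ m → suc (suc i ⊓ i) ∷ suc m ∷ []) (trans (m≥n⇒m⊓n≡n (n≤1+n i)) (sym (⊓-idem i)))
crown-profile {τ = even} {a = R} {i} {e = e} with refl ← height-top {i = i} e = refl
crown-profile {τ = even} {a = Z} {i} {e = e} with refl ← height-top {i = i} e = refl

up-profile : ∀ {a i j b} .{e : i + j ≡ K} →
  map (λ x → level x ⊓ suc K) (up {β = β} {τ = τ} a i j e b) ≡ map (_⊓ suc K) (2 + i ∷ 1 + i ∷ [])
up-profile {j = zero}  = crown-profile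
up-profile {j = suc j} = refl

nb-profile : (v : V β τ K) → map (λ x → level x ⊓ suc K) (nb v) ≡ map (_⊓ suc K) (profile β (level v))
nb-profile (base (apex b))   = refl
nb-profile (base tip)        = refl
nb-profile (base (foot L b)) = refl
nb-profile (base (foot R b)) = refl
nb-profile (base (foot Z b)) = refl
nb-profile (arm a zero j e b)    = cong (0 ∷_) (up-profile {a = a} {j = j} {b})
nb-profile (arm a (suc i) j e b) = cong (suc i ⊓ suc _ ∷_) (up-profile {a = a} {j = j} {b})
nb-profile {K = K} (top (mid b)) = cong (λ m → suc (K ⊓ K) ∷ suc m ∷ suc (suc K ⊓ K) ∷ [])
  (trans (⊓-idem K) (sym (m≥n⇒m⊓n≡n (m≤n+m K 2))))
nb-profile {K = K} (top (cap false b)) = cong₂ (λ m n → suc (K ⊓ K) ∷ suc m ∷ suc n ∷ [])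
  (trans (m≥n⇒m⊓n≡n (n≤1+n K)) (sym (m≥n⇒m⊓n≡n (m≤n+m K 2))))
  (trans (⊓-idem K) (sym (m≥n⇒m⊓n≡n (n≤1+n K))))
nb-profile {K = K} (top (cap true b)) = cong₂ (λ m n → suc (K ⊓ K) ∷ suc m ∷ suc n ∷ [])
  (trans (m≥n⇒m⊓n≡n (n≤1+n K)) (sym (m≥n⇒m⊓n≡n (m≤n+m K 2))))
  (trans (⊓-idem K) (sym (m≥n⇒m⊓n≡n (n≤1+n K))))

map-≡⇒pointwise : ∀ {A B : Set} (f : A → B) {xs ys} → map f xs ≡ map f ys → Pointwise (λ x y → f x ≡ f y) xs ys
map-≡⇒pointwise f {[]}     {[]}     _ = []
map-≡⇒pointwise f {x ∷ xs} {y ∷ ys} e = let a , b = ∷-injective e in a ∷ map-≡⇒pointwise f b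

⊓-pred : ∀ {a b p} → a ⊓ suc p ≡ b ⊓ suc p → a ⊓ p ≡ b ⊓ p
⊓-pred {a} {b} {p} e = trans (sym (absorb a)) (trans (cong (_⊓ p) e) (absorb b))
  where
  absorb : ∀ a → a ⊓ suc p ⊓ p ≡ a ⊓ p
  absorb a = trans (⊓-assoc a (suc p) p) (cong (a ⊓_) (m≥n⇒m⊓n≡n (n≤1+n p)))

nb-profile-cap : ∀ {p} → p ≤ suc K → (v : V β τ K) →
  map (λ x → level x ⊓ p) (nb v) ≡ map (_⊓ p) (profile β (level v))
nb-profile-cap {K} {β} {p = p} p≤ v = trans (recap level (nb v)) (trans (cong (map (_⊓ p)) (nb-profile v))
  (trans (sym (map-∘ (profile β (level v)))) (map-cong absorb (profile β (level v)))))
  where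
  absorb : ∀ a → a ⊓ suc K ⊓ p ≡ a ⊓ p
  absorb a = trans (⊓-assoc a (suc K) p) (cong (a ⊓_) (m≥n⇒m⊓n≡n p≤))
  recap : ∀ {A : Set} (f : A → ℕ) xs → map (λ x → f x ⊓ p) xs ≡ map (_⊓ p) (map (λ x → f x ⊓ suc K) xs)
  recap f xs = trans (map-cong (sym ∘ absorb ∘ f) xs) (map-∘ xs)

-- The wave rises one level per round: neighbours are at most one level lower, so a level known up
-- to `suc p` fixes their levels up to `p`.
profile-cap : ∀ β {a b p} → a ⊓ suc p ≡ b ⊓ suc p → map (_⊓ p) (profile β a) ≡ map (_⊓ p) (profile β b)
profile-cap β {zero}  {zero}      e = refl
profile-cap β {suc a} {suc b} {p} e = cong₂ _∷_ e₀ (cong₂ _∷_ (up' {suc a} {suc b} e₁) (cong (_∷ []) e₁))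
  where
  up' : ∀ {a b} → a ⊓ p ≡ b ⊓ p → suc a ⊓ p ≡ suc b ⊓ p
  up' e = ⊓-pred (cong suc e)
  e₀ : a ⊓ p ≡ b ⊓ p
  e₀ = suc-injective e
  e₁ : suc a ⊓ p ≡ suc b ⊓ p
  e₁ = up' {a} {b} e₀

capped-next : {E : Relation β τ K} → ∀ {p} → p ≤ suc K → Capped E p →
  ∀ v w → level v ⊓ suc p ≡ level w ⊓ suc p → Next E v w
capped-next {β} {E = E} {p} p≤ c v w e = Pointwise.map (λ {x} {y} → c x y)
  (map-≡⇒pointwise (λ x → level x ⊓ p)
    (trans (nb-profile-cap p≤ v) (trans (profile-cap β {level v} {level w} e) (sym (nb-profile-cap p≤ w)))))

level-flip : (v : V β τ K) → level (flip v) ≡ level v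
level-flip (base (apex b))   = refl
level-flip (base tip)        = refl
level-flip (base (foot a b)) = refl
level-flip (arm a i j e b)   = refl
level-flip (top (mid b))     = refl
level-flip (top (cap s b))   = refl

level-swap : (v : V β τ K) → level (swap v) ≡ level v
level-swap (base (apex b))   = refl
level-swap (base tip)        = refl
level-swap (base (foot L b)) = refl
level-swap (base (foot R b)) = refl
level-swap (base (foot Z b)) = refl
level-swap (arm L i j e b)   = refl
level-swap (arm R i j e b)   = refl
level-swap (arm Z i j e b)   = refl
level-swap (top (mid b))     = refl
level-swap (top (cap false b)) = refl
level-swap (top (cap true b))  = refl

level-fold : (v : V β τ K) → level (fold v) ≡ level v
level-fold (base (apex b))   = refl
level-fold (base tip)        = refl
level-fold (base (foot L b)) = refl
level-fold (base (foot R b)) = refl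
level-fold (base (foot Z b)) = refl
level-fold (arm L i j e b)   = refl
level-fold (arm R i j e b)   = refl
level-fold (arm Z i j e b)   = refl
level-fold (top (mid b))     = refl
level-fold (top (cap false b)) = refl
level-fold (top (cap true b))  = refl

-- The phases of the refinement

-- The threshold of the swaps moves from `swapStart` to one above `crownLevel`. Up to the last of
-- these rounds the swaps at `crownLevel` are still available to keep the highest pair of L
-- together.
swapRounds : Base → Top → ℕ → ℕ
swapRounds fork τ K = crownLevel τ K
swapRounds cut  τ K = suc (crownLevel τ K)

lastIndex : Base → Top → ℕ → ℕ
lastIndex fork τ K = K + offsetZ fork τ K
lastIndex cut  τ K = suc (K + offsetZ cut τ K)

-- After this number of rounds only last and flip last have the same colour.
rounds : Base → Top → ℕ → ℕ
rounds β τ K = lastIndex β τ K + (swapRounds β τ K + ((2 + K) + (2 + K)))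

last : ∀ {β'} → β' ≡ β → V β τ K
last {β' = fork} _    = lowest Z false
last {β' = cut}  refl = base (foot Z false)

module Rounds (β : Base) (τ : Top) (K : ℕ) where
  open Layout (snake β τ K) using (graph; Alike; alike-suc⁺)
  open Refinement graph

  alike-equiv : ∀ i → IsEquivalence (Alike i)
  alike-equiv i = record { refl = same-refl i ; sym = same-sym i ; trans = same-trans i }

  -- The first phase. It is followed only up to round `2 + K`, since the neighbour levels are
  -- uniform only when capped at `suc K`.
  capped : ∀ p → p ≤ 2 + K → Capped (Alike p) p
  capped zero    _         v w _ = same _
  capped (suc p) (s≤s p≤) v w e =
    alike-suc⁺ (capped p (m≤n⇒m≤1+n p≤) v w (⊓-pred {level v} {level w} e))
               (capped-next p≤ (capped p (m≤n⇒m≤1+n p≤)) v w e)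

  level-alike : ∀ v w → level v ≡ level w → Alike (2 + K) v w
  level-alike v w e = capped (2 + K) ≤-refl v w (cong (_⊓ (2 + K)) e)

  -- The second phase, in which L becomes distinguishable from R. At `q = 2 + K` the field `folds`
  -- is vacuous, as no depth exceeds `suc K`.
  record Folding (q i : ℕ) : Set where
    field
      flips : FlipFrom (Alike i) 0
      swaps : SwapFrom (Alike i) 0
      folds : FoldFrom (Alike i) q

  folding : ∀ q → q ≤ 2 + K → Folding q (q + (2 + K))
  folding zero _ = record
    { flips = λ v _ → level-alike v (flip v) (sym (level-flip v))
    ; swaps = λ v _ → level-alike v (swap v) (sym (level-swap v))
    ; folds = λ v _ → level-alike v (fold v) (sym (level-fold v))
    }
  folding (suc q) (s≤s q≤) = record
    { flips = λ v h → alike-suc⁺ (flips v h) (flip-next equiv 0 0 (λ _ → z≤n) (λ _ v _ → swaps v z≤n) flips v h)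
    ; swaps = λ v h → alike-suc⁺ (swaps v h) (swap-next equiv 0 0 (λ _ → z≤n) flips (λ _ → feet β refl) swaps v h)
    ; folds = λ v h → alike-suc⁺ (folds v (≤-trans (n≤1+n q) h)) (fold-next equiv q flips swaps folds v h)
    }
    where
    open Folding (folding q (m≤n⇒m≤1+n q≤))
    i     = q + (2 + K)
    equiv = alike-equiv i
    -- The base pair below L has depth `suc K`, and `q≤` ensures that its fold is still intact. For
    -- `cut` the fold only reaches the feet of R, and a swap completes the way to Z.
    feet : ∀ β' → β' ≡ β → ∀ b → Alike i (base (footOf L b)) (base (footOf Z b))
    feet fork refl b = folds (base (apex b)) q≤
    feet cut  refl b = same-trans i (folds (base (foot L b)) q≤) (swaps (base (foot R b)) z≤n)

  record Swapping (s i : ℕ) : Set where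
    field
      flips : FlipFrom (Alike i) 0
      swaps : SwapFrom (Alike i) s

  -- The third phase. The difference between R and Z climbs one level per round; `feet` is vacuous
  -- because the threshold has passed `swapStart`.
  swapping : ∀ t → t ≤ swapRounds β τ K → Swapping (t + swapStart β) (t + ((2 + K) + (2 + K)))
  swapping zero _ = record { flips = flips ; swaps = λ v _ → swaps v z≤n }
    where open Folding (folding (2 + K) ≤-refl)
  swapping (suc t) t< = record
    { flips = λ v h → alike-suc⁺ (flips v h) (flip-next equiv 0 0 (λ _ → z≤n)
                (λ _ v h → swaps v (≤-trans (t+start≤ β refl) h)) flips v h)
    ; swaps = λ v h → alike-suc⁺ (swaps v (≤-trans (n≤1+n _) h)) (swap-next equiv s (suc s) s≤s⁻¹ flips
                (λ s< → contradiction (≤-trans s< (m≤n+m (swapStart β) t)) 1+n≰n) swaps v h)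
    }
    where
    open Swapping (swapping t (≤-trans (n≤1+n t) t<))
    s     = t + swapStart β
    equiv = alike-equiv (t + ((2 + K) + (2 + K)))
    t+start≤ : ∀ β' → β' ≡ β → t + swapStart β ≤ crownLevel τ K
    t+start≤ fork refl = subst (_≤ crownLevel τ K) (+-comm 1 t) t<
    t+start≤ cut  refl = subst (_≤ crownLevel τ K) (sym (+-identityʳ t)) (s≤s⁻¹ t<)

  -- The fourth phase, one path position per round. The highest pair of L has position 0 and is
  -- given up at once, so the premise about swaps is vacuous.
  flipping : ∀ p → FlipFrom (Alike (p + (swapRounds β τ K + ((2 + K) + (2 + K))))) p
  flipping zero    = Swapping.flips (swapping (swapRounds β τ K) ≤-refl)
  flipping (suc p) v h = alike-suc⁺ (flipping p v (≤-trans (n≤1+n p) h))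
    (flip-next (alike-equiv _) p (suc p) s≤s⁻¹ (λ ()) (flipping p) v h)

  last-alike : ∀ {β'} (eq : β' ≡ β) → Alike (rounds β τ K) (last eq) (flip (last eq))
  last-alike {fork} refl = flipping _ (lowest Z false) ≤-refl
  last-alike {cut}  refl = flipping _ (base (foot Z false)) ≤-refl

-- A stable colouring separates all pairs

level-down : ∀ {a i j b} .{e : i + j ≡ K} → level (down {β = β} {τ} a i j e b) ≡ i
level-down {i = zero}  = refl
level-down {i = suc i} = refl

crown-level : ∀ {a i b} .{e : i + 0 ≡ K} → All (λ y → suc i ≤ level y) (crown {β = β} {τ = τ} a i e b)
crown-level {τ = odd} {L} {b = false} = ≤-refl ∷ ≤-refl ∷ []
crown-level {τ = odd} {L} {b = true}  = ≤-refl ∷ ≤-refl ∷ []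
crown-level {τ = odd} {R} {e = e}     = m≤n⇒m≤1+n (s≤s (≤-reflexive (height-top e))) ∷ ≤-refl ∷ []
crown-level {τ = odd} {Z} {e = e}     = m≤n⇒m≤1+n (s≤s (≤-reflexive (height-top e))) ∷ ≤-refl ∷ []
crown-level {τ = even} {L} {e = e}    = i≤ ∷ i≤ ∷ []
  where i≤ = m≤n⇒m≤1+n (s≤s (≤-reflexive (height-top e)))
crown-level {τ = even} {R} {e = e}    = m≤n⇒m≤1+n (s≤s (≤-reflexive (height-top e))) ∷ ≤-refl ∷ []
crown-level {τ = even} {Z} {e = e}    = m≤n⇒m≤1+n (s≤s (≤-reflexive (height-top e))) ∷ ≤-refl ∷ []

up-level : ∀ {a i j b} .{e : i + j ≡ K} → All (λ y → suc i ≤ level y) (up {β = β} {τ} a i j e b)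
up-level {j = zero}  = crown-level
up-level {j = suc j} = n≤1+n _ ∷ ≤-refl ∷ []

nb-level : (v : V β τ K) → All (λ y → level v ≤ suc (level y)) (nb v)
nb-level (base (apex b))       = z≤n ∷ z≤n ∷ z≤n ∷ z≤n ∷ []
nb-level (base tip)            = z≤n ∷ z≤n ∷ z≤n ∷ z≤n ∷ []
nb-level (base (foot L b))     = z≤n ∷ z≤n ∷ []
nb-level (base (foot R b))     = z≤n ∷ z≤n ∷ []
nb-level (base (foot Z b))     = z≤n ∷ z≤n ∷ []
nb-level (arm a i j e b)       = s≤s (≤-reflexive (sym level-down)) ∷ All.map m≤n⇒m≤1+n (up-level {a = a} {j = j} {b})
nb-level (top (mid b))         = ≤-refl ∷ ≤-refl ∷ n≤1+n _ ∷ []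
nb-level (top (cap false b))   = ≤-refl ∷ n≤1+n _ ∷ ≤-refl ∷ []
nb-level (top (cap true b))    = ≤-refl ∷ n≤1+n _ ∷ ≤-refl ∷ []

-- Together with `nb-level` this makes `level` the distance to the base.
nb-below : (v : V β τ K) → ∀ {k} → level v ≡ suc k → ∃ λ x → x ∈ nb v × level x ≡ k
nb-below (arm a i j e b)     refl = _ , here refl , level-down
nb-below (top (mid b))       refl = _ , here refl , refl
nb-below (top (cap false b)) refl = _ , here refl , refl
nb-below (top (cap true b))  refl = _ , here refl , refl

-- The highest pairs of R and Z have neighbours of this level, but the highest pair of L does not.
crownMark : Top → ℕ → ℕ
crownMark odd  i = 2 + i
crownMark even i = 1 + i

crown-marked : ∀ {a i b} .{e : i + 0 ≡ K} → a ≢ L →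
  ∃ λ x → x ∈ crown {β = β} {τ = τ} a i e b × level x ≡ crownMark τ i
crown-marked {a = L} a≢L = contradiction refl a≢L
crown-marked {τ = odd} {R} {e = e}  _ = _ , here refl , cong (2 +_) (sym (height-top e))
crown-marked {τ = odd} {Z} {e = e}  _ = _ , here refl , cong (2 +_) (sym (height-top e))
crown-marked {τ = even} {R} _ = _ , there (here refl) , refl
crown-marked {τ = even} {Z} _ = _ , there (here refl) , refl

crown-unmarked : ∀ {i b} .{e : i + 0 ≡ K} → All (λ y → level y ≢ crownMark τ i) (crown {β = β} {τ = τ} L i e b)
crown-unmarked {τ = odd} {b = false} = (λ ()) ∷ (λ ()) ∷ []
crown-unmarked {τ = odd} {b = true}  = (λ ()) ∷ (λ ()) ∷ []
crown-unmarked {τ = even} {i = i} {e = e} = ≢mark ∷ ≢mark ∷ []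
  where
  ≢mark : 2 + _ ≢ 1 + i
  ≢mark eq with refl ← height-top {i = i} e = contradiction eq λ ()

i≢crownMark : ∀ τ {i} → i ≢ crownMark τ i
i≢crownMark odd  ()
i≢crownMark even ()

depth-unique : ∀ {i j j'} → .(i + j ≡ K) → .(i + j' ≡ K) → j ≡ j'
depth-unique {K} {i} {j} {j'} e e' = +-cancelˡ-≡ i j j'
  (trans (recompute (i + j ≟ K) e) (sym (recompute (i + j' ≟ K) e')))

height≢ : ∀ {i j} → .(i + j ≡ K) → i ≢ suc K
height≢ {K} {i} {j} e refl = 1+n≰n (subst (suc K ≤_) (recompute (suc K + j ≟ K) e) (m≤m+n (suc K) j))

-- The L side and the R side, including the base and top vertices that belong to them. Both are
-- shown to be unions of classes.
left? right? : V β τ K → Bool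
left? (base (apex _))   = true
left? (base (foot L _)) = true
left? (arm L _ _ _ _)   = true
left? _                 = false

right? (base (foot R _))   = true
right? (arm R _ _ _ _)     = true
right? (top (cap false _)) = true
right? _                   = false

length-nb : (v : V β τ K) → length (nb v) ≡ length (profile β (level v))
length-nb {β} v = trans (sym (length-map _ (nb v)))
  (trans (cong length (nb-profile v)) (length-map _ (profile β (level v))))

-- Stability enters in the form of a bisimulation that respects degrees. Every separation below
-- exhibits a neighbour of one vertex that is related to no neighbour of the other.
module Discrete {β τ K} {E : Relation β τ K} (equiv : IsEquivalence E)
  (degree : ∀ v w → E v w → length (nb v) ≡ length (nb w))
  (bisim : ∀ v w {x} → E v w → x ∈ nb v → ∃ λ y → y ∈ nb w × E x y) where

  open IsEquivalence equiv using () renaming (sym to E-sym)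

  unmatched : ∀ {v w x} → E v w → x ∈ nb v → All (λ y → ¬ E x y) (nb w) → ⊥
  unmatched vw x∈ none = let _ , y∈ , xy = bisim _ _ vw x∈ in All.lookup none y∈ xy

  profile-zero : ∀ β {k} → length (profile β 0) ≡ length (profile β k) → k ≡ 0
  profile-zero β    {zero}  _ = refl
  profile-zero fork {suc k} ()
  profile-zero cut  {suc k} ()

  -- The degree singles out level 0. A vertex at level `suc k` has a neighbour at level `k`, whose
  -- partner has level at most `k` by induction and is adjacent to `w`.
  level-bound : ∀ k {v w} → E v w → level v ≤ k → level w ≤ k
  level-bound zero {v} {w} vw v≤ = ≤-reflexive (profile-zero β
    (trans (cong (length ∘ profile β) (sym (n≤0⇒n≡0 v≤))) (trans (sym (length-nb v)) (trans (degree v w vw) (length-nb w)))))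
  level-bound (suc k) {v} {w} vw v≤ with m≤n⇒m<n∨m≡n v≤
  ... | inj₁ v< = m≤n⇒m≤1+n (level-bound k vw (s≤s⁻¹ v<))
  ... | inj₂ v≡ = let x , x∈ , x≡ = nb-below v v≡ ; y , y∈ , xy = bisim v w vw x∈ in
    ≤-trans (All.lookup (nb-level w) y∈) (s≤s (level-bound k xy (≤-reflexive x≡)))

  E-level : ∀ {v w} → E v w → level v ≡ level w
  E-level vw = ≤-antisym (level-bound _ (E-sym vw) ≤-refl) (level-bound _ vw ≤-refl)

  level≢ : ∀ {v w} → level v ≢ level w → ¬ E v w
  level≢ ≢ vw = ≢ (E-level vw)

  down≢ : ∀ {x a i j b} .{e : i + j ≡ K} → level x ≢ i → ¬ E x (down a i j e b)
  down≢ ≢ xy = ≢ (trans (E-level xy) level-down)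

  up≢ : ∀ {x a i j b} .{e : i + j ≡ K} → level x ≤ i → All (λ y → ¬ E x y) (up a i j e b)
  up≢ {x} {a} {i} {j} {b} x≤ = All.map
    (λ i< xy → 1+n≰n (≤-trans i< (≤-trans (≤-reflexive (sym (E-level xy))) x≤)))
    (up-level {a = a} {i} {j} {b})

  left-crown : ∀ {a i b b'} .{e : i + 0 ≡ K} → a ≢ L → ¬ E (arm L i 0 e b) (arm a i 0 e b')
  left-crown {i = i} a≢L vw =
    let x , x∈ , x≡ = crown-marked a≢L in
    unmatched (E-sym vw) (there x∈)
      (down≢ (λ eq → i≢crownMark τ (trans (sym eq) x≡)) ∷
       All.map (λ y≢ xy → y≢ (trans (sym (E-level xy)) x≡)) crown-unmarked)

  arm-level : ∀ {a a' i i' j j' b b'} .{e : i + j ≡ K} .{e' : i' + j' ≡ K} →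
    E (arm a i j e b) (arm a' i' j' e' b') → arm {β = β} {τ} a' i' j' e' b' ≡ arm a' i j e b'
  arm-level {i = i} {i'} {j} {j'} {e = e} {e'} vw =
    arm-cong (sym i≡i') (sym (depth-unique {i = i} e (subst (λ m → m + j' ≡ K) (sym i≡i') e')))
    where
    i≡i' : i ≡ i'
    i≡i' = suc-injective (E-level vw)

  -- Induction on the depth, from the top down. The highest pair of L lacks the marked neighbour;
  -- below it, the next higher vertex of L would have to be related to a vertex off L.
  left-arm : ∀ j {i b w} .{e : i + j ≡ K} → E (arm L i j e b) w → T (left? w)
  left-arm' : ∀ j {i a b b'} .{e : i + j ≡ K} → a ≢ L → ¬ E (arm L i j e b) (arm a i j e b')

  left-arm j {w = base _} vw = contradiction vw (level≢ λ ())
  left-arm j {w = top _} {e} vw = contradiction (suc-injective (E-level vw)) (height≢ e)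
  left-arm j {w = arm L _ _ _ _} vw = tt
  left-arm j {w = arm R _ _ _ _} vw = ⊥-elim (left-arm' j (λ ()) (subst (E _) (arm-level vw) vw))
  left-arm j {w = arm Z _ _ _ _} vw = ⊥-elim (left-arm' j (λ ()) (subst (E _) (arm-level vw) vw))

  left-arm' zero    a≢L vw = left-crown a≢L vw
  left-arm' (suc j) {a = L} a≢L vw = a≢L refl
  left-arm' (suc j) {a = R} a≢L vw = unmatched vw (there (here refl))
    (down≢ (λ ()) ∷ (λ xy → left-arm j xy) ∷ level≢ (λ ()) ∷ [])
  left-arm' (suc j) {a = Z} a≢L vw = unmatched vw (there (here refl))
    (down≢ (λ ()) ∷ (λ xy → left-arm j xy) ∷ level≢ (λ ()) ∷ [])

  left-closed : ∀ {v w} → E v w → T (left? v) → T (left? w)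
  left-closed {arm L i j e b} vw _ = left-arm j vw
  left-closed {base _} {arm _ _ _ _ _} vw _ = contradiction vw (level≢ λ ())
  left-closed {base _} {top _} vw _ = contradiction vw (level≢ λ ())
  left-closed {base (apex b)} {base (apex b')} vw _ = tt
  left-closed {base (apex b)} {base tip} vw _ = unmatched vw (here refl)
    (left-arm _ ∷ left-arm _ ∷ level≢ (λ ()) ∷ level≢ (λ ()) ∷ [])
  left-closed {base (foot L b)} {base (foot L b')} vw _ = tt
  left-closed {base (foot L b)} {base (foot R b')} vw _ = unmatched vw (here refl) (left-arm _ ∷ level≢ (λ ()) ∷ [])
  left-closed {base (foot L b)} {base (foot Z b')} vw _ = unmatched vw (here refl) (left-arm _ ∷ level≢ (λ ()) ∷ [])

  -- The difference crosses the base: R stands on the L side itself for `fork`, and its feet have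
  -- neighbours there for `cut`; neither holds for Z.
  foot-R : ∀ {β'} (eq : β' ≡ β) {b b'} →
    ¬ E (base (subst BaseVertex eq (footOf R b))) (base (subst BaseVertex eq (footOf Z b')))
  foot-R {fork} refl vw = left-closed vw tt
  foot-R {cut}  refl vw = unmatched vw (there (here refl)) (level≢ (λ ()) ∷ (λ xy → left-closed xy tt) ∷ [])

  right-arm : ∀ i {j b w} .{e : i + j ≡ K} → E (arm R i j e b) w → T (right? w)
  right-arm i {w = base _} vw = contradiction vw (level≢ λ ())
  right-arm i {w = top _} {e} vw = contradiction (suc-injective (E-level vw)) (height≢ e)
  right-arm i {w = arm L _ _ _ _} vw = ⊥-elim (left-closed (E-sym vw) tt)
  right-arm i {w = arm R _ _ _ _} vw = tt
  right-arm zero {j} {w = arm Z i' j' e' b'} vw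
    with refl ← E-level vw = ⊥-elim (unmatched vw (here refl) (foot-R refl ∷ up≢ {a = Z} {j = j'} {b'} z≤n))
  right-arm (suc i) {j} {w = arm Z i' j' e' b'} vw
    with refl ← E-level vw = ⊥-elim (unmatched vw (here refl) (right-arm i ∷ up≢ {a = Z} {j = j'} {b'} ≤-refl))

  right-closed : ∀ {v w} → E v w → T (right? v) → T (right? w)
  right-closed {arm R i j e b} vw _ = right-arm i vw
  right-closed {base (foot R b)} {arm _ _ _ _ _} vw _ = contradiction vw (level≢ λ ())
  right-closed {base (foot R b)} {top _} vw _ = contradiction vw (level≢ λ ())
  right-closed {base (foot R b)} {base (foot L b')} vw _ = left-closed (E-sym vw) tt
  right-closed {base (foot R b)} {base (foot R b')} vw _ = tt
  right-closed {base (foot R b)} {base (foot Z b')} vw _ = foot-R refl vw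
  right-closed {top (cap false b)} {base _} vw _ = contradiction vw (level≢ λ ())
  right-closed {top (cap false b)} {arm _ i j e _} vw _ = contradiction (suc-injective (sym (E-level vw))) (height≢ e)
  right-closed {top (cap false b)} {top (cap false b')} vw _ = tt
  right-closed {top (cap false b)} {top (cap true b')} vw _ = unmatched vw (here refl)
    (right-arm K ∷ level≢ (λ ()) ∷ (λ xy → left-closed (E-sym xy) tt) ∷ [])

  Rigid : V β τ K → Set
  Rigid v = ¬ E v (flip v)

  -- The two vertices see different sides, and `right-closed` has separated these.
  rigid-L-crown : ∀ {τ'} → τ' ≡ τ → ∀ {i} .{e : i + 0 ≡ K} → ¬ E (arm L i 0 e false) (arm L i 0 e true)
  rigid-L-crown {odd} refl vw = unmatched vw (there (here refl))
    (down≢ (λ ()) ∷ (λ xy → right-closed xy tt) ∷ (λ xy → right-closed xy tt) ∷ [])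
  rigid-L-crown {even} refl {i} {e} vw with refl ← height-top {i = i} e = unmatched vw (there (here refl))
    (down≢ (λ ()) ∷ (λ xy → right-closed xy tt) ∷ (λ xy → right-closed xy tt) ∷ [])

  -- From here rigidity is handed on along the path of `pathIndex`: each pair is joined to its
  -- predecessor vertex by vertex, and the remaining neighbours are excluded by level or side.
  rigid-L : ∀ j {i b} .{e : i + j ≡ K} → Rigid (arm L i j e b)
  rigid-L zero {b = false} = rigid-L-crown refl
  rigid-L zero {b = true}  = rigid-L-crown refl ∘ E-sym
  rigid-L (suc j) vw = unmatched vw (there (here refl)) (down≢ (λ ()) ∷ rigid-L j ∷ level≢ (λ ()) ∷ [])

  rigid-foot-L : ∀ {β'} (eq : β' ≡ β) {b} → Rigid (base (subst BaseVertex eq (footOf L b)))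
  rigid-foot-L {fork} refl vw = unmatched vw (here refl)
    (rigid-L K ∷ (λ xy → left-closed xy tt) ∷ level≢ (λ ()) ∷ level≢ (λ ()) ∷ [])
  rigid-foot-L {cut}  refl vw = unmatched vw (here refl) (rigid-L K ∷ level≢ (λ ()) ∷ [])

  rigid-foot-R : ∀ {β'} (eq : β' ≡ β) {b} →
    ¬ E (base (subst BaseVertex eq (footOf R b))) (base (subst BaseVertex eq (footOf R (not b))))
  rigid-foot-R {fork} refl = rigid-foot-L refl
  rigid-foot-R {cut}  refl vw = unmatched vw (there (here refl)) (level≢ (λ ()) ∷ rigid-foot-L refl ∷ [])

  rigid-R : ∀ i {j b} .{e : i + j ≡ K} → Rigid (arm R i j e b)
  rigid-R zero    {j} {b} vw = unmatched vw (here refl) (rigid-foot-R refl ∷ up≢ {a = R} {j = j} {not b} z≤n)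
  rigid-R (suc i) {j} {b} vw = unmatched vw (here refl) (rigid-R i ∷ up≢ {a = R} {j = j} {not b} ≤-refl)

  rigid-right-top : (u : TopVertex τ) → T (right? {β} {τ} {K} (top u)) → Rigid (top u)
  rigid-right-top (cap false b) _ vw = unmatched vw (here refl)
    (rigid-R K ∷ level≢ (λ ()) ∷ (λ xy → left-closed (E-sym xy) tt) ∷ [])

  rigid-top : (u : TopVertex τ) → Rigid (top u)
  rigid-top (mid b) vw = unmatched vw (here refl)
    (rigid-R K ∷ (λ xy → right-closed xy tt) ∷ level≢ (λ ()) ∷ [])
  rigid-top (cap false b) = rigid-right-top (cap false b) tt
  rigid-top (cap true b) vw = unmatched vw (there (here refl))
    (level≢ (λ ()) ∷ rigid-right-top (cap false b) tt ∷ level≢ (λ ()) ∷ [])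

  rigid-Z-crown : ∀ {τ'} → τ' ≡ τ → ∀ {i b} .{e : i + 0 ≡ K} → Rigid (arm Z i 0 e b)
  rigid-Z-crown {odd} refl {i} {b} {e} vw with refl ← height-top {i = i} e = unmatched vw (there (here refl))
    (down≢ (λ ()) ∷ rigid-top (mid b) ∷ level≢ (λ ()) ∷ [])
  rigid-Z-crown {even} refl {i} {b} {e} vw with refl ← height-top {i = i} e = unmatched vw (there (here refl))
    (down≢ (λ ()) ∷ rigid-top (cap true b) ∷ level≢ (λ ()) ∷ [])

  rigid-Z : ∀ j {i b} .{e : i + j ≡ K} → Rigid (arm Z i j e b)
  rigid-Z zero       = rigid-Z-crown refl
  rigid-Z (suc j) vw = unmatched vw (there (here refl)) (down≢ (λ ()) ∷ rigid-Z j ∷ level≢ (λ ()) ∷ [])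

  rigid-last : ∀ {β'} (eq : β' ≡ β) → Rigid (last eq)
  rigid-last {fork} refl = rigid-Z K
  rigid-last {cut}  refl vw = unmatched vw (here refl) (rigid-Z K ∷ level≢ (λ ()) ∷ [])

-- Adding a hub

bit : Bool → ℕ
bit b = if b then 1 else 0

count-suc : ∀ {n} (p : Fin (suc n) → Bool) → count p ≡ bit (p zero) + count (p ∘ suc)
count-suc {n} p = head (length-filter-tabulate id)
  where
  length-filter-tabulate : ∀ {m} (f : Fin m → Fin n) →
    length (filter (T? ∘ p) (tabulate (suc ∘ f))) ≡ length (filter (T? ∘ p ∘ suc) (tabulate f))
  length-filter-tabulate {zero}  f = refl
  length-filter-tabulate {suc m} f with p (suc (f zero))
  ... | true  = cong suc (length-filter-tabulate (f ∘ suc))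
  ... | false = length-filter-tabulate (f ∘ suc)
  head : ∀ {m} {xs} → length (filter (T? ∘ p) xs) ≡ m → length (filter (T? ∘ p) (zero ∷ xs)) ≡ bit (p zero) + m
  head e with p zero
  ... | true  = cong suc e
  ... | false = e

¬T⇒false : ∀ {b} → ¬ T b → b ≡ false
¬T⇒false {false} _ = refl
¬T⇒false {true}  h = contradiction _ h

module Hub {n : ℕ} (G : Graph n) (d : ℕ) where
  open Refinement G

  degree : Fin n → ℕ
  degree x = count (λ y → adj G x y ∧ true)

  low : Fin n → Bool
  low x = degree x ≡ᵇ d

  hubAdj : Fin (suc n) → Fin (suc n) → Bool
  hubAdj zero    zero    = false
  hubAdj zero    (suc y) = low y
  hubAdj (suc x) zero    = low x
  hubAdj (suc x) (suc y) = adj G x y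

  hub : Graph (suc n)
  hub = record { adj = hubAdj ; sym = hub-sym ; irrefl = hub-irrefl }
    where
    hub-sym : ∀ x y → hubAdj x y ≡ hubAdj y x
    hub-sym zero    zero    = refl
    hub-sym zero    (suc y) = refl
    hub-sym (suc x) zero    = refl
    hub-sym (suc x) (suc y) = Graph.sym G x y
    hub-irrefl : ∀ x → hubAdj x x ≡ false
    hub-irrefl zero    = refl
    hub-irrefl (suc x) = irrefl G x

  private module H = Refinement hub

  hubCount : ∀ i v u → H.nbrCount i v u ≡
    bit (hubAdj v zero ∧ sameColour hub i zero u) + count (λ z → hubAdj v (suc z) ∧ sameColour hub i (suc z) u)
  hubCount i v u = count-suc (λ x → hubAdj v x ∧ sameColour hub i x u)

  module _ (degrees : ∀ x → degree x ≡ d ⊎ degree x ≡ suc d)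
           (lows : count (λ y → low y ∧ true) ≢ suc d) where

    -- The hub equalises all degrees but its own.
    degree-hub : ∀ x u → H.nbrCount 0 (suc x) u ≡ suc d
    degree-hub x u = trans (hubCount 0 (suc x) u) (go (degrees x))
      where
      n≢1+n : ∀ {m} → (suc m ≡ᵇ m) ≡ false
      n≢1+n {zero}  = refl
      n≢1+n {suc m} = n≢1+n {m}
      n≡n : ∀ {m} → (m ≡ᵇ m) ≡ true
      n≡n {zero}  = refl
      n≡n {suc m} = n≡n {m}
      go : degree x ≡ d ⊎ degree x ≡ suc d → bit (low x ∧ true) + degree x ≡ suc d
      go (inj₁ e) rewrite e | n≡n {d} = refl
      go (inj₂ e) rewrite e | n≢1+n {d} = refl

    -- By `lows` the degree of the hub is not `suc d`, the degree that all other vertices now have.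
    hub-separated : ∀ j {y} → ¬ H.Same (suc j) zero (suc y)
    hub-separated j {y} s = lows (trans (sym (hubCount 0 zero zero))
      (trans (proj₂ (H.suc⁻ (H.same-≤ (s≤s z≤n) s)) zero) (degree-hub y zero)))

    hub-count-old : ∀ j → (∀ {z u} → sameColour hub (suc j) (suc z) (suc u) ≡ sameColour G j z u) →
      ∀ x u → H.nbrCount (suc j) (suc x) (suc u) ≡ nbrCount j x u
    hub-count-old j eq x u = trans (hubCount (suc j) (suc x) (suc u)) (cong₂ _+_
      (cong bit (trans (cong (low x ∧_) (¬T⇒false (hub-separated j {u} ∘ H.same))) (∧-zeroʳ (low x))))
      (count-cong (λ z → cong (adj G x z ∧_) eq)))

    hub-count-new : ∀ j {x y} → low x ≡ low y → H.nbrCount (suc j) (suc x) zero ≡ H.nbrCount (suc j) (suc y) zero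
    hub-count-new j {x} {y} e = trans (hubCount (suc j) (suc x) zero) (trans (cong₂ _+_
      (cong (λ b → bit (b ∧ sameColour hub (suc j) zero zero)) e)
      (count-cong (λ z → trans (none x z) (sym (none y z))))) (sym (hubCount (suc j) (suc y) zero)))
      where
      none : ∀ x z → adj G x z ∧ sameColour hub (suc j) (suc z) zero ≡ false
      none x z = trans (cong (adj G x z ∧_) (¬T⇒false (hub-separated j {z} ∘ H.same-sym (suc j) ∘ H.same)))
                       (∧-zeroʳ (adj G x z))

    same-low : ∀ {j x y} → Same (suc j) x y → low x ≡ low y
    same-low {x = x} s = cong (_≡ᵇ d) (proj₂ (suc⁻ (same-≤ (s≤s z≤n) s)) x)

    -- Round `suc j` with the hub agrees with round `j` without it. The first round only isolates
    -- the hub. Afterwards adjacency to the hub reveals whether a vertex is `low`, which the first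
    -- round on `G` reveals as well.
    same-hub⁺ : ∀ j {x y} → Same j x y → H.Same (suc j) (suc x) (suc y)
    same-hub⁻ : ∀ j {x y} → H.Same (suc j) (suc x) (suc y) → Same j x y
    same-hub  : ∀ j {x y} → sameColour hub (suc j) (suc x) (suc y) ≡ sameColour G j x y
    same-hub j = T-injective (holds ∘ same-hub⁻ j ∘ H.same) (H.holds ∘ same-hub⁺ j ∘ same)

    same-hub⁺ zero {x} {y} _ = H.suc⁺ (H.same _) λ u → trans (degree-hub x u) (sym (degree-hub y u))
    same-hub⁺ (suc j) {x} {y} s = H.suc⁺ (same-hub⁺ j (same-pred s)) λ where
      zero    → hub-count-new j (same-low s)
      (suc u) → trans (hub-count-old j (same-hub j) x u)
                  (trans (proj₂ (suc⁻ s) u) (sym (hub-count-old j (same-hub j) y u)))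

    same-hub⁻ zero    _ = same _
    same-hub⁻ (suc j) {x} {y} s = suc⁺ (same-hub⁻ j (H.same-pred s)) λ u →
      trans (sym (hub-count-old j (same-hub j) x u))
        (trans (proj₂ (H.suc⁻ s) (suc u)) (hub-count-old j (same-hub j) y u))

    hub-unstable : ∀ {j} → ¬ Stable G j → ¬ Stable hub (suc j)
    hub-unstable {j} ¬st st = ¬st (same-suc⇒stable {j} λ x y s →
      same-hub⁻ (suc j) (H.stable⇒same-suc {suc j} st (same-hub⁺ j s)))

-- Order 10

allB-cong : ∀ {A : Set} {p q : A → Bool} → (∀ x → p x ≡ q x) → ∀ xs → allB p xs ≡ allB q xs
allB-cong h []       = refl
allB-cong h (x ∷ xs) = cong₂ _∧_ (h x) (allB-cong h xs)

-- Evaluating sameColour directly takes time exponential in the round; a table shares the previous round.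
module Tabulated {n : ℕ} (G : Graph n) where

  Table : Set
  Table = Vec (Vec Bool n) n

  at : Table → Fin n → Fin n → Bool
  at t v w = Vec.lookup (Vec.lookup t v) w

  next : Table → Table
  next t = Vec.tabulate λ v → Vec.tabulate λ w → at t v w ∧
    allB (λ u → count (λ x → adj G v x ∧ at t x u) ≡ᵇ count (λ x → adj G w x ∧ at t x u)) (allFin n)

  table : ℕ → Table
  table zero    = Vec.replicate n (Vec.replicate n true)
  table (suc i) = next (table i)

  at-tabulate : ∀ (f : Fin n → Fin n → Bool) v w → at (Vec.tabulate λ v → Vec.tabulate (f v)) v w ≡ f v w
  at-tabulate f v w = trans
    (cong (λ r → Vec.lookup r w) (lookup∘tabulate (λ v → Vec.tabulate (f v)) v)) (lookup∘tabulate (f v) w)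

  table-sameColour : ∀ i v w → at (table i) v w ≡ sameColour G i v w
  table-sameColour zero    v w = trans
    (cong (λ r → Vec.lookup r w) (lookup-replicate v (Vec.replicate n true))) (lookup-replicate w true)
  table-sameColour (suc i) v w = trans (at-tabulate _ v w)
    (cong₂ _∧_ (table-sameColour i v w) (allB-cong (λ u → cong₂ _≡ᵇ_ (counts v u) (counts w u)) (allFin n)))
    where
    counts : ∀ v u → count (λ x → adj G v x ∧ at (table i) x u) ≡ count (λ x → adj G v x ∧ sameColour G i x u)
    counts v u = count-cong (λ x → cong (adj G v x ∧_) (table-sameColour i x u))

-- A record, because comparing instances of Stable would unfold sameColour.
record Unstable (r : ℕ) : Set where
  constructor unstable
  field
    {graph}  : Graph (2 + r)
    unsettled : ¬ Stable graph r

table-unstable : ∀ {r} (G : Graph (2 + r)) (v w : Fin (2 + r)) → let open Tabulated G in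
  at (table r) v w ≡ true → at (table (suc r)) v w ≡ false → Unstable r
table-unstable {r} G v w e e' = unstable {graph = G} λ st → absurd (trans (sym e) (trans (table-sameColour r v w)
    (trans (st v w) (trans (sym (table-sameColour (suc r) v w)) e'))))
  where
  open Tabulated G
  absurd : true ≢ false
  absurd ()

-- Found by computer search.
adjacency₁₀ : Vec (Vec ℕ 10) 10
adjacency₁₀ =
  (0 ∷ 1 ∷ 1 ∷ 0 ∷ 1 ∷ 1 ∷ 0 ∷ 0 ∷ 0 ∷ 0 ∷ []) ∷
  (1 ∷ 0 ∷ 0 ∷ 1 ∷ 0 ∷ 0 ∷ 1 ∷ 1 ∷ 0 ∷ 0 ∷ []) ∷
  (1 ∷ 0 ∷ 0 ∷ 0 ∷ 1 ∷ 0 ∷ 0 ∷ 0 ∷ 1 ∷ 1 ∷ []) ∷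
  (0 ∷ 1 ∷ 0 ∷ 0 ∷ 0 ∷ 1 ∷ 0 ∷ 0 ∷ 1 ∷ 1 ∷ []) ∷
  (1 ∷ 0 ∷ 1 ∷ 0 ∷ 0 ∷ 0 ∷ 1 ∷ 0 ∷ 0 ∷ 0 ∷ []) ∷
  (1 ∷ 0 ∷ 0 ∷ 1 ∷ 0 ∷ 0 ∷ 0 ∷ 1 ∷ 0 ∷ 0 ∷ []) ∷
  (0 ∷ 1 ∷ 0 ∷ 0 ∷ 1 ∷ 0 ∷ 0 ∷ 0 ∷ 1 ∷ 0 ∷ []) ∷
  (0 ∷ 1 ∷ 0 ∷ 0 ∷ 0 ∷ 1 ∷ 0 ∷ 0 ∷ 0 ∷ 1 ∷ []) ∷
  (0 ∷ 0 ∷ 1 ∷ 1 ∷ 0 ∷ 0 ∷ 1 ∷ 0 ∷ 0 ∷ 1 ∷ []) ∷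
  (0 ∷ 0 ∷ 1 ∷ 1 ∷ 0 ∷ 0 ∷ 0 ∷ 1 ∷ 1 ∷ 0 ∷ []) ∷ []

adj₁₀ : Fin 10 → Fin 10 → Bool
adj₁₀ x y = Vec.lookup (Vec.lookup adjacency₁₀ x) y ≡ᵇ 1

graph₁₀ : Graph 10
graph₁₀ = record
  { adj    = adj₁₀
  ; sym    = toWitness {a? = Fin.all? λ x → Fin.all? λ y → adj₁₀ x y ≟ᵇ adj₁₀ y x} _
  ; irrefl = toWitness {a? = Fin.all? λ x → adj₁₀ x x ≟ᵇ false} _
  }

-- Evaluation shows that the vertices 8 and 9 share their colour after 8 rounds but not after 9.
unstable₁₀ : Unstable 8
unstable₁₀ = table-unstable graph₁₀ (# 8) (# 9) refl refl

-- Instability of the witnesses and the orders they cover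

snakeGraph : ∀ β τ K → Graph (size β τ K)
snakeGraph β τ K = Layout.graph (snake β τ K)

-- If this round were stable, its colouring would be a bisimulation and `last` would be rigid, but
-- `last-alike` still confuses that pair.
snake-unstable : ∀ β τ K → ¬ Stable (snakeGraph β τ K) (rounds β τ K)
snake-unstable β τ K stable = rigid-last refl (last-alike refl)
  where
  open Rounds β τ K
  open Layout (snake β τ K) using (graph; Alike; alike-degree; alike-nb)
  open Refinement graph
  r = rounds β τ K
  onwards : ∀ v w → Alike r v w → Alike (suc r) v w
  onwards v w = stable⇒same-suc {r} stable
  same-degree : ∀ v w → Alike r v w → length (nb v) ≡ length (nb w)
  same-degree v w s = alike-degree {r} {v} {w} (onwards v w s)
  bisim : ∀ v w {x} → Alike r v w → x ∈ nb v → ∃ λ y → y ∈ nb w × Alike r x y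
  bisim v w s = alike-nb {r} {v} {w} (onwards v w s)
  open Discrete (alike-equiv r) same-degree bisim

snakeDegree : Base → ℕ
snakeDegree fork = 3
snakeDegree cut  = 2

module _ (β : Base) (τ : Top) (K : ℕ) where
  open Layout (snake β τ K) using (graph; index; vertex; index-vertex; index-injective; nbrCount-zero)

  private
    d = snakeDegree β

    module SnakeHub = Hub graph d

    degree-index : ∀ (v : V β τ K) → SnakeHub.degree (index v) ≡ length (nb v)
    degree-index v = nbrCount-zero v (index v)

    profile-degree : ∀ β k → length (profile β k) ≡ snakeDegree β ⊎ length (profile β k) ≡ suc (snakeDegree β)
    profile-degree fork zero    = inj₂ refl
    profile-degree fork (suc k) = inj₁ refl
    profile-degree cut  zero    = inj₁ refl
    profile-degree cut  (suc k) = inj₂ refl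

    degrees : ∀ x → SnakeHub.degree x ≡ d ⊎ SnakeHub.degree x ≡ suc d
    degrees x = subst (λ m → m ≡ d ⊎ m ≡ suc d)
      (trans (sym (trans (degree-index (vertex x)) (length-nb (vertex x)))) (cong SnakeHub.degree (index-vertex x)))
      (profile-degree β (level (vertex x)))

    -- A sample of `2 + d` vertices of degree `d` suffices to show that the number of such vertices
    -- is not `suc d`.
    lowVertices : ∀ {β'} → β' ≡ β → List (V β τ K)
    lowVertices {fork} refl = lowest L false ∷ lowest L true ∷ lowest R false ∷ lowest R true ∷ lowest Z false ∷ []
    lowVertices {cut}  refl = base (foot L false) ∷ base (foot L true) ∷ base (foot R false) ∷ base (foot R true) ∷ []

    lowVertices-unique : ∀ {β'} (eq : β' ≡ β) → Unique (lowVertices eq)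
    lowVertices-unique {fork} refl =
      ((λ ()) ∷ (λ ()) ∷ (λ ()) ∷ (λ ()) ∷ []) ∷ ((λ ()) ∷ (λ ()) ∷ (λ ()) ∷ []) ∷ triple-unique (λ ()) (λ ()) (λ ())
    lowVertices-unique {cut}  refl = ((λ ()) ∷ (λ ()) ∷ (λ ()) ∷ []) ∷ triple-unique (λ ()) (λ ()) (λ ())

    lowVertices-low : ∀ {β'} (eq : β' ≡ β) → All (λ v → length (profile β (level v)) ≡ d) (lowVertices eq)
    lowVertices-low {fork} refl = refl ∷ refl ∷ refl ∷ refl ∷ refl ∷ []
    lowVertices-low {cut}  refl = refl ∷ refl ∷ refl ∷ refl ∷ []

    lowVertices-length : ∀ {β'} (eq : β' ≡ β) → length (lowVertices eq) ≡ 2 + d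
    lowVertices-length {fork} refl = refl
    lowVertices-length {cut}  refl = refl

    lows : count (λ y → SnakeHub.low y ∧ true) ≢ suc d
    lows eq = 1+n≰n (subst₂ _≤_ (trans (length-map index (lowVertices refl)) (lowVertices-length refl)) eq
      (count-≥ SnakeHub.low (Unique.map⁺ index-injective (lowVertices-unique refl))
        (AllProps.map⁺ (All.map (λ {v} e → ≡⇒≡ᵇ _ d (trans (degree-index v) (trans (length-nb v) e))) (lowVertices-low refl)))))

  hubGraph : Graph (suc (size β τ K))
  hubGraph = SnakeHub.hub

  hubGraph-unstable : ¬ Stable hubGraph (suc (rounds β τ K))
  hubGraph-unstable = SnakeHub.hub-unstable degrees lows {rounds β τ K} (snake-unstable β τ K)

-- The durations of the four phases add up to exactly the number needed for the bound to be
-- attained. Each case is a closed polynomial identity in `K`.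
size≡2+rounds : ∀ β τ K → size β τ K ≡ 2 + rounds β τ K
size≡2+rounds fork odd  = lemma
  where
  lemma : ∀ K → 3 + (3 * (suc K * 2) + 2) ≡ 2 + (K + (2 + (K + (2 + K))) + ((1 + K) + ((2 + K) + (2 + K))))
  lemma = solve-∀
size≡2+rounds fork even = lemma
  where
  lemma : ∀ K → 3 + (3 * (suc K * 2) + 4) ≡ 2 + (K + (3 + (K + (2 + K))) + ((2 + K) + ((2 + K) + (2 + K))))
  lemma = solve-∀
size≡2+rounds cut  odd  = lemma
  where
  lemma : ∀ K → 6 + (3 * (suc K * 2) + 2) ≡ 2 + (suc (K + (2 + (K + (3 + K)))) + (suc (1 + K) + ((2 + K) + (2 + K))))
  lemma = solve-∀
size≡2+rounds cut  even = lemma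
  where
  lemma : ∀ K → 6 + (3 * (suc K * 2) + 4) ≡ 2 + (suc (K + (3 + (K + (3 + K)))) + (suc (2 + K) + ((2 + K) + (2 + K))))
  lemma = solve-∀

unstable-resize : ∀ {n r} (G : Graph n) → ¬ Stable G r → n ≡ 2 + r → Unstable r
unstable-resize G ¬stable refl = unstable ¬stable

unstable-snake : ∀ β τ K → Unstable (rounds β τ K)
unstable-snake β τ K = unstable-resize (snakeGraph β τ K) (snake-unstable β τ K) (size≡2+rounds β τ K)

unstable-hub : ∀ β τ K → Unstable (suc (rounds β τ K))
unstable-hub β τ K = unstable-resize (hubGraph β τ K) (hubGraph-unstable β τ K) (cong suc (size≡2+rounds β τ K))

rounds-linear : ∀ β τ K → rounds β τ K ≡ rounds β τ 0 + K * 6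
rounds-linear β τ K = +-cancelˡ-≡ 2 _ _ (trans (sym (size≡2+rounds β τ K)) (trans (lemma (baseSize β) (topSize τ) K)
  (cong (_+ K * 6) (size≡2+rounds β τ 0))))
  where
  lemma : ∀ b t K → b + (3 * (suc K * 2) + t) ≡ b + (3 * (1 * 2) + t) + K * 6
  lemma = solve-∀

-- At `K = 0` the four snakes run for 9, 11, 12 and 14 rounds, and the hubs fill the gaps 10 and 13;
-- each further level adds 6.
unstable-residue : ∀ (r : Fin 6) q → Unstable (9 + (toℕ r + q * 6))
unstable-residue zero q = subst Unstable (rounds-linear fork odd q) (unstable-snake fork odd q)
unstable-residue (suc zero) q = subst Unstable (cong suc (rounds-linear fork odd q)) (unstable-hub fork odd q)
unstable-residue (suc (suc zero)) q = subst Unstable (rounds-linear fork even q) (unstable-snake fork even q)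
unstable-residue (suc (suc (suc zero))) q = subst Unstable (rounds-linear cut odd q) (unstable-snake cut odd q)
unstable-residue (suc (suc (suc (suc zero)))) q = subst Unstable (cong suc (rounds-linear cut odd q)) (unstable-hub cut odd q)
unstable-residue (suc (suc (suc (suc (suc zero))))) q = subst Unstable (rounds-linear cut even q) (unstable-snake cut even q)

unstable-from-8 : ∀ m → Unstable (8 + m)
unstable-from-8 zero    = unstable₁₀
unstable-from-8 (suc m) with result q r eq ← m divMod 6 =
  subst (λ k → Unstable (9 + k)) (sym eq) (unstable-residue r q)

unstable⇒isWL1Max : ∀ {r n} → Unstable r → 2 + r ≡ n → IsWL1Max n (n ∸ 1)
unstable⇒isWL1Max (unstable {G} ¬stable) refl = (G , unstable⇒isWL1 G ¬stable) , isWL1-bound (s≤s z≤n)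

theorem1 : (n : ℕ) → 10 ≤ n → (n ≡ 12 ⊎ (n % 18 ≢ 6 × n % 18 ≢ 12)) →
    IsWL1Max n (n ∸ 1)
theorem1 n 10≤n _ = unstable⇒isWL1Max (unstable-from-8 (n ∸ 10)) (m+[n∸m]≡n 10≤n)
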